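{- Let $a$ be a real number that is algebraic over $\mathbb{Q}$, and let $\mathbb{Q}(a)^+=\{x\in\mathbb{Q}(a): x>0\}$. Then $\mathbb{Q}(a)^+$ cannot be written as $H_1\sqcup H_2$ with $H_1,H_2$ disjoint nonempty subsets, each closed under addition and multiplication. -}

module Defs where

open import Data.Nat.Base as ℕ using (ℕ)
import Data.Nat.Properties as ℕₚ
open import Data.Rational.Base as ℚ using (ℚ; 0ℚ; 1ℚ; ½; ∣_∣)
import Data.Rational.Properties as ℚₚ
open import Data.List.Base using (List; foldr)
open import Data.List.Relation.Unary.Any using (Any)
open import Data.Product.Base using (∃; _×_; _,_)
open import Level using (0ℓ)
open import Relation.Binary.PropositionalEquality
  using (_≡_; _≢_; sym; trans; cong; cong₂; subst)
open import Relation.Nullary.Decidable.Core using (dec⇒maybe)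
open import Relation.Unary using (Pred)
open import Tactic.RingSolver using (solve-∀)
open import Tactic.RingSolver.Core.AlmostCommutativeRing
  using (AlmostCommutativeRing; fromCommutativeRing)

------------------------------------------------------------------------
-- Real numbers: Cauchy sequences of rationals, considered up to _≈_

IsCauchy : (ℕ → ℚ) → Set
IsCauchy x = ∀ ε → 0ℚ ℚ.< ε →
  ∃ λ N → ∀ m n → N ℕ.≤ m → N ℕ.≤ n → ∣ x m ℚ.- x n ∣ ℚ.< ε

record ℝ : Set where
  constructor mkℝ
  field
    seq    : ℕ → ℚ
    cauchy : IsCauchy seq

open ℝ public

infix 4 _≈_ _<_ _∈ℚ⟨_⟩

record _≈_ (x y : ℝ) : Set where
  constructor mk≈
  field
    close : ∀ ε → 0ℚ ℚ.< ε →
      ∃ λ N → ∀ n → N ℕ.≤ n → ∣ seq x n ℚ.- seq y n ∣ ℚ.< ε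

-- The gap is uniform in n: eventual pointwise inequality alone would
-- not be invariant under _≈_.
record _<_ (x y : ℝ) : Set where
  constructor mk<
  field
    gap   : ℚ
    0<gap : 0ℚ ℚ.< gap
    apart : ∃ λ N → ∀ n → N ℕ.≤ n → gap ℚ.< seq y n ℚ.- seq x n

open _≈_ public
open _<_ public

private
  ℚ-ring : AlmostCommutativeRing 0ℓ 0ℓ
  ℚ-ring = fromCommutativeRing ℚₚ.+-*-commutativeRing (λ p → dec⇒maybe (0ℚ ℚₚ.≟ p))

  +-sub : ∀ a b c d → (a ℚ.+ b) ℚ.- (c ℚ.+ d) ≡ (a ℚ.- c) ℚ.+ (b ℚ.- d)
  +-sub = solve-∀ ℚ-ring

  sub-add : ∀ a b → a ≡ (a ℚ.- b) ℚ.+ b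
  sub-add = solve-∀ ℚ-ring

  *-sub : ∀ a b c d → a ℚ.* b ℚ.- c ℚ.* d ≡ a ℚ.* (b ℚ.- d) ℚ.+ d ℚ.* (a ℚ.- c)
  *-sub = solve-∀ ℚ-ring

  half-pos : ∀ ε → 0ℚ ℚ.< ε → 0ℚ ℚ.< ½ ℚ.* ε
  half-pos ε 0<ε = ℚₚ.*-monoʳ-<-pos ½ 0<ε

  halves : ∀ ε → ½ ℚ.* ε ℚ.+ ½ ℚ.* ε ≡ ε
  halves ε = trans (sym (ℚₚ.*-distribʳ-+ ε ½ ½)) (ℚₚ.*-identityˡ ε)

  abstract
    const-cauchy : ∀ q → IsCauchy (λ _ → q)
    const-cauchy q ε 0<ε = 0 , λ _ _ _ _ →
      subst (ℚ._< ε) (sym (cong ∣_∣ (ℚₚ.+-inverseʳ q))) 0<ε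

    +-cauchy : ∀ x y → IsCauchy x → IsCauchy y →
               IsCauchy (λ n → x n ℚ.+ y n)
    +-cauchy x y cx cy ε 0<ε
      with cx (½ ℚ.* ε) (half-pos ε 0<ε) | cy (½ ℚ.* ε) (half-pos ε 0<ε)
    ... | M , hx | N , hy = M ℕ.⊔ N , λ m n m≥ n≥ →
      let open ℚₚ.≤-Reasoning in begin-strict
      ∣ (x m ℚ.+ y m) ℚ.- (x n ℚ.+ y n) ∣
        ≡⟨ cong ∣_∣ (+-sub (x m) (y m) (x n) (y n)) ⟩
      ∣ (x m ℚ.- x n) ℚ.+ (y m ℚ.- y n) ∣
        ≤⟨ ℚₚ.∣p+q∣≤∣p∣+∣q∣ (x m ℚ.- x n) (y m ℚ.- y n) ⟩
      ∣ x m ℚ.- x n ∣ ℚ.+ ∣ y m ℚ.- y n ∣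
        <⟨ ℚₚ.+-mono-<
             (hx m n (ℕₚ.m⊔n≤o⇒m≤o M N m≥) (ℕₚ.m⊔n≤o⇒m≤o M N n≥))
             (hy m n (ℕₚ.m⊔n≤o⇒n≤o M N m≥) (ℕₚ.m⊔n≤o⇒n≤o M N n≥)) ⟩
      ½ ℚ.* ε ℚ.+ ½ ℚ.* ε
        ≡⟨ halves ε ⟩
      ε ∎

    neg-cauchy : ∀ x → IsCauchy x → IsCauchy (λ n → ℚ.- x n)
    neg-cauchy x cx ε 0<ε with cx ε 0<ε
    ... | N , hx = N , λ m n m≥ n≥ → subst (ℚ._< ε) (sym (flip m n)) (hx m n m≥ n≥)
      where
      flip : ∀ m n → ∣ ℚ.- x m ℚ.- (ℚ.- x n) ∣ ≡ ∣ x m ℚ.- x n ∣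
      flip m n = trans
        (cong ∣_∣ (sym (ℚₚ.neg-distrib-+ (x m) (ℚ.- x n))))
        (ℚₚ.∣-p∣≡∣p∣ (x m ℚ.- x n))

    eventually-bounded : ∀ x → IsCauchy x →
      ∃ λ B → 0ℚ ℚ.< B × ∃ λ N → ∀ n → N ℕ.≤ n → ∣ x n ∣ ℚ.≤ B
    eventually-bounded x cx with cx 1ℚ (ℚₚ.positive⁻¹ 1ℚ)
    ... | N , h = 1ℚ ℚ.+ ∣ x N ∣
        , ℚₚ.+-mono-<-≤ (ℚₚ.positive⁻¹ 1ℚ) (ℚₚ.0≤∣p∣ (x N))
        , N , λ n n≥ → let open ℚₚ.≤-Reasoning in begin
      ∣ x n ∣
        ≡⟨ cong ∣_∣ (sub-add (x n) (x N)) ⟩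
      ∣ (x n ℚ.- x N) ℚ.+ x N ∣
        ≤⟨ ℚₚ.∣p+q∣≤∣p∣+∣q∣ (x n ℚ.- x N) (x N) ⟩
      ∣ x n ℚ.- x N ∣ ℚ.+ ∣ x N ∣
        ≤⟨ ℚₚ.+-monoˡ-≤ ∣ x N ∣ (ℚₚ.<⇒≤ (h n N n≥ ℕₚ.≤-refl)) ⟩
      1ℚ ℚ.+ ∣ x N ∣ ∎

    *-mono-≤-< : ∀ p q r s → 0ℚ ℚ.≤ r → 0ℚ ℚ.< q →
                 p ℚ.≤ q → r ℚ.< s → p ℚ.* r ℚ.< q ℚ.* s
    *-mono-≤-< p q r s 0≤r 0<q p≤q r<s = ℚₚ.≤-<-trans
      (ℚₚ.*-monoʳ-≤-nonNeg r {{ℚ.nonNegative 0≤r}} p≤q)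
      (ℚₚ.*-monoʳ-<-pos q {{ℚ.positive 0<q}} r<s)

    quotient : ∀ d ε → 0ℚ ℚ.< d → 0ℚ ℚ.< ε → ∃ λ δ → 0ℚ ℚ.< δ × d ℚ.* δ ≡ ε
    quotient d ε 0<d 0<ε = (ℚ.1/ d) ℚ.* ε
      , ℚₚ.positive⁻¹ ((ℚ.1/ d) ℚ.* ε)
          {{ℚₚ.pos*pos⇒pos (ℚ.1/ d) {{ℚₚ.1/pos⇒pos d}} ε {{ℚ.positive 0<ε}}}}
      , trans (sym (ℚₚ.*-assoc d (ℚ.1/ d) ε))
          (trans (cong (ℚ._* ε) (ℚₚ.*-inverseʳ d)) (ℚₚ.*-identityˡ ε))
      where
      instance
        d-pos : ℚ.Positive d
        d-pos = ℚ.positive 0<d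
        d-nonZero : ℚ.NonZero d
        d-nonZero = ℚₚ.pos⇒nonZero d

    *-close : ∀ a b c d B C δ → 0ℚ ℚ.< B → 0ℚ ℚ.< C →
              ∣ a ∣ ℚ.≤ B → ∣ d ∣ ℚ.≤ C →
              ∣ a ℚ.- c ∣ ℚ.< δ → ∣ b ℚ.- d ∣ ℚ.< δ →
              ∣ a ℚ.* b ℚ.- c ℚ.* d ∣ ℚ.< (B ℚ.+ C) ℚ.* δ
    *-close a b c d B C δ 0<B 0<C a≤B d≤C ac<δ bd<δ =
      let open ℚₚ.≤-Reasoning in begin-strict
      ∣ a ℚ.* b ℚ.- c ℚ.* d ∣
        ≡⟨ cong ∣_∣ (*-sub a b c d) ⟩
      ∣ a ℚ.* (b ℚ.- d) ℚ.+ d ℚ.* (a ℚ.- c) ∣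
        ≤⟨ ℚₚ.∣p+q∣≤∣p∣+∣q∣ (a ℚ.* (b ℚ.- d)) (d ℚ.* (a ℚ.- c)) ⟩
      ∣ a ℚ.* (b ℚ.- d) ∣ ℚ.+ ∣ d ℚ.* (a ℚ.- c) ∣
        ≡⟨ cong₂ ℚ._+_ (ℚₚ.∣p*q∣≡∣p∣*∣q∣ a (b ℚ.- d)) (ℚₚ.∣p*q∣≡∣p∣*∣q∣ d (a ℚ.- c)) ⟩
      ∣ a ∣ ℚ.* ∣ b ℚ.- d ∣ ℚ.+ ∣ d ∣ ℚ.* ∣ a ℚ.- c ∣
        <⟨ ℚₚ.+-mono-<
             (*-mono-≤-< (∣ a ∣) B (∣ b ℚ.- d ∣) δ (ℚₚ.0≤∣p∣ (b ℚ.- d)) 0<B a≤B bd<δ)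
             (*-mono-≤-< (∣ d ∣) C (∣ a ℚ.- c ∣) δ (ℚₚ.0≤∣p∣ (a ℚ.- c)) 0<C d≤C ac<δ) ⟩
      B ℚ.* δ ℚ.+ C ℚ.* δ
        ≡⟨ ℚₚ.*-distribʳ-+ δ B C ⟨
      (B ℚ.+ C) ℚ.* δ ∎

    -- Plain projections instead of with-abstraction, which would normalise
    -- the rational products in the goal.
    *-cauchy : ∀ x y → IsCauchy x → IsCauchy y →
               IsCauchy (λ n → x n ℚ.* y n)
    *-cauchy x y cx cy ε 0<ε =
      let B , 0<B , K , hB = eventually-bounded x cx
          C , 0<C , L , hC = eventually-bounded y cy
          δ , 0<δ , Dδ≡ε   = quotient (B ℚ.+ C) ε (ℚₚ.+-mono-< 0<B 0<C) 0<ε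
          M , hx           = cx δ 0<δ
          N , hy           = cy δ 0<δ
          KL≤ : ∀ {o} → (K ℕ.⊔ L) ℕ.⊔ (M ℕ.⊔ N) ℕ.≤ o → K ℕ.⊔ L ℕ.≤ o
          KL≤ = ℕₚ.m⊔n≤o⇒m≤o (K ℕ.⊔ L) (M ℕ.⊔ N)
          MN≤ : ∀ {o} → (K ℕ.⊔ L) ℕ.⊔ (M ℕ.⊔ N) ℕ.≤ o → M ℕ.⊔ N ℕ.≤ o
          MN≤ = ℕₚ.m⊔n≤o⇒n≤o (K ℕ.⊔ L) (M ℕ.⊔ N)
      in (K ℕ.⊔ L) ℕ.⊔ (M ℕ.⊔ N) , λ m n m≥ n≥ →
        subst (∣ x m ℚ.* y m ℚ.- x n ℚ.* y n ∣ ℚ.<_) Dδ≡ε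
          (*-close (x m) (y m) (x n) (y n) B C δ 0<B 0<C
            (hB m (ℕₚ.m⊔n≤o⇒m≤o K L (KL≤ m≥)))
            (hC n (ℕₚ.m⊔n≤o⇒n≤o K L (KL≤ n≥)))
            (hx m n (ℕₚ.m⊔n≤o⇒m≤o M N (MN≤ m≥)) (ℕₚ.m⊔n≤o⇒m≤o M N (MN≤ n≥)))
            (hy m n (ℕₚ.m⊔n≤o⇒n≤o M N (MN≤ m≥)) (ℕₚ.m⊔n≤o⇒n≤o M N (MN≤ n≥))))

infixl 6 _+_
infixl 7 _*_
infix  8 -_

fromℚ : ℚ → ℝ
fromℚ q = mkℝ (λ _ → q) (const-cauchy q)

0ℝ 1ℝ : ℝ
0ℝ = fromℚ 0ℚ
1ℝ = fromℚ 1ℚ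

_+_ : ℝ → ℝ → ℝ
x + y = mkℝ (λ n → seq x n ℚ.+ seq y n) (+-cauchy (seq x) (seq y) (cauchy x) (cauchy y))

-_ : ℝ → ℝ
- x = mkℝ (λ n → ℚ.- seq x n) (neg-cauchy (seq x) (cauchy x))

_*_ : ℝ → ℝ → ℝ
x * y = mkℝ (λ n → seq x n ℚ.* seq y n) (*-cauchy (seq x) (seq y) (cauchy x) (cauchy y))

------------------------------------------------------------------------
-- Algebraic numbers

-- c₀ ∷ c₁ ∷ … ∷ [] stands for c₀ + c₁ X + …; trailing zeros are allowed.
Poly : Set
Poly = List ℚ

NonZeroPoly : Pred Poly 0ℓ
NonZeroPoly = Any (_≢ 0ℚ)

eval : Poly → ℝ → ℝ
eval p x = foldr (λ c r → fromℚ c + x * r) 0ℝ p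

AlgebraicOverℚ : Pred ℝ 0ℓ
AlgebraicOverℚ a = ∃ λ p → NonZeroPoly p × eval p a ≈ 0ℝ

------------------------------------------------------------------------
-- ℚ(a), the smallest subfield of ℝ containing a

-- The element is a variable related by _≈_ to the result of each operation,
-- so that this is a subset of the quotient of ℝ by _≈_.
data _∈ℚ⟨_⟩ (x a : ℝ) : Set where
  gen : x ≈ a → x ∈ℚ⟨ a ⟩
  rat : ∀ q → x ≈ fromℚ q → x ∈ℚ⟨ a ⟩
  add : ∀ {y z} → y ∈ℚ⟨ a ⟩ → z ∈ℚ⟨ a ⟩ → x ≈ y + z → x ∈ℚ⟨ a ⟩
  neg : ∀ {y} → y ∈ℚ⟨ a ⟩ → x ≈ - y → x ∈ℚ⟨ a ⟩
  mul : ∀ {y z} → y ∈ℚ⟨ a ⟩ → z ∈ℚ⟨ a ⟩ → x ≈ y * z → x ∈ℚ⟨ a ⟩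
  inv : ∀ {y} → y ∈ℚ⟨ a ⟩ → x * y ≈ 1ℝ → x ∈ℚ⟨ a ⟩

ℚ⟨_⟩⁺ : ℝ → Pred ℝ 0ℓ
ℚ⟨ a ⟩⁺ x = x ∈ℚ⟨ a ⟩ × 0ℝ < x

------------------------------------------------------------------------
-- Closure of subsets of ℝ under the semiring operations

ClosedUnder : ∀ {ℓ} → (ℝ → ℝ → ℝ) → Pred ℝ ℓ → Set ℓ
ClosedUnder _∙_ H = ∀ {x y} → H x → H y → H (x ∙ y)

{-# OPTIONS --safe #-}

-- Let P be the part containing 1 and M the other one. Clearing denominators, P contains the
-- positive rationals, so both parts are stable under scaling by them. The identity
-- (x + 2q)² = x² + 4q(x + q) shows that M, and hence P, is stable under every rational
-- translation that keeps the element positive, so P and M extend to complementary convex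
-- cones U and L in ℚ(a), invariant under translation by ℚ. A functional f separating these
-- cones satisfies f(y²) = 2y f(y): for rationals q < y < N near y, (y - q)² lies in M if
-- y ∈ L, and (N - y)² in P. So f is a derivation. It vanishes at the algebraic number a
-- (differentiate p(a) = 0 repeatedly), hence on all of ℚ(a), which forces M to be empty.
-- As f need not be finite, it is replaced by the ratios f(y) / f(x) with x ∈ M.

module Submission where

open import Defs
open import Data.Empty using (⊥-elim)
open import Data.Integer.Base as ℤ using (+_; -[1+_]; +[1+_])
import Data.Integer.Properties as ℤₚ
import Data.Integer.Tactic.RingSolver as ℤ-Solver
open import Data.List.Base using ([]; _∷_; length)
open import Data.List.Relation.Unary.Any using (here; there; any?)
open import Data.Nat.Base as ℕ using (ℕ; zero; suc)
import Data.Nat.Properties as ℕₚ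
open import Data.Product.Base using (∃; ∃₂; _×_; _,_; proj₁; proj₂)
open import Data.Rational.Base as ℚ using (ℚ; mkℚ; 0ℚ; 1ℚ; ½; toℚᵘ; ∣_∣)
import Data.Rational.Properties as ℚₚ
open import Data.Rational.Unnormalised.Base as ℚᵘ using (mkℚᵘ; *≡*)
import Data.Rational.Unnormalised.Properties as ℚᵘₚ
open import Data.Sum.Base as Sum using (_⊎_; inj₁; inj₂; fromInj₁; fromInj₂)
open import Algebra.Definitions.RawMonoid ℚ.+-0-rawMonoid using () renaming (_×_ to _·_)
open import Level using (Level; 0ℓ)
open import Relation.Binary.Definitions using (_Respects_; Tri; tri<; tri≈; tri>)
open import Relation.Binary.PropositionalEquality
  using (_≡_; _≢_; refl; sym; trans; cong; cong₂; subst; module ≡-Reasoning)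
open import Relation.Nullary.Decidable.Core using (yes; no; dec⇒maybe; ¬?)
open import Relation.Nullary.Negation.Core using (¬_)
open import Relation.Unary using (Pred; Satisfiable; _∪_; _≐_; _⊥_)
open import Tactic.RingSolver using (solve-∀)
open import Tactic.RingSolver.Core.AlmostCommutativeRing
  using (AlmostCommutativeRing; fromCommutativeRing)

ℚ-ring : AlmostCommutativeRing 0ℓ 0ℓ
ℚ-ring = fromCommutativeRing ℚₚ.+-*-commutativeRing (λ p → dec⇒maybe (0ℚ ℚₚ.≟ p))

-- Rational numbers

*-pos : ∀ {p q} → 0ℚ ℚ.< p → 0ℚ ℚ.< q → 0ℚ ℚ.< p ℚ.* q
*-pos {p} {q} 0<p 0<q =
  ℚₚ.positive⁻¹ (p ℚ.* q) {{ℚₚ.pos*pos⇒pos p {{ℚ.positive 0<p}} q {{ℚ.positive 0<q}}}}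

+-pos : ∀ {p q} → 0ℚ ℚ.< p → 0ℚ ℚ.< q → 0ℚ ℚ.< p ℚ.+ q
+-pos = ℚₚ.+-mono-<

½*-pos : ∀ {q} → 0ℚ ℚ.< q → 0ℚ ℚ.< ½ ℚ.* q
½*-pos = *-pos (ℚₚ.positive⁻¹ ½)

halves : ∀ q → ½ ℚ.* q ℚ.+ ½ ℚ.* q ≡ q
halves q = trans (sym (ℚₚ.*-distribʳ-+ q ½ ½)) (ℚₚ.*-identityˡ q)

reciprocal : ∀ {q} → 0ℚ ℚ.< q → ∃ λ r → 0ℚ ℚ.< r × q ℚ.* r ≡ 1ℚ
reciprocal {q} 0<q = ℚ.1/ q , ℚₚ.positive⁻¹ (ℚ.1/ q) {{ℚₚ.1/pos⇒pos q}} , ℚₚ.*-inverseʳ q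
  where
  instance
    q-pos : ℚ.Positive q
    q-pos = ℚ.positive 0<q
    q-nonZero : ℚ.NonZero q
    q-nonZero = ℚₚ.pos⇒nonZero q

reciprocal-cancel : ∀ q r x → q ℚ.* r ≡ 1ℚ → r ℚ.* (q ℚ.* x) ≡ x
reciprocal-cancel q r x qr≡1 =
  trans (swap q r x) (trans (cong (ℚ._* x) qr≡1) (ℚₚ.*-identityˡ x))
  where
  swap : ∀ q r x → r ℚ.* (q ℚ.* x) ≡ (q ℚ.* r) ℚ.* x
  swap = solve-∀ ℚ-ring

<⇒0<- : ∀ {p q} → p ℚ.< q → 0ℚ ℚ.< q ℚ.- p
<⇒0<- {p} {q} p<q = subst (ℚ._< q ℚ.- p) (ℚₚ.+-inverseʳ p) (ℚₚ.+-monoˡ-< (ℚ.- p) p<q)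

0<-⇒< : ∀ {p q} → 0ℚ ℚ.< q ℚ.- p → p ℚ.< q
0<-⇒< {p} {q} h = begin-strict
  p                ≡⟨ ℚₚ.+-identityˡ p ⟨
  0ℚ ℚ.+ p         <⟨ ℚₚ.+-monoˡ-< p h ⟩
  q ℚ.- p ℚ.+ p    ≡⟨ cancel p q ⟩
  q                ∎
  where
  open ℚₚ.≤-Reasoning
  cancel : ∀ p q → q ℚ.- p ℚ.+ p ≡ q
  cancel = solve-∀ ℚ-ring

0<-neg : ∀ {q} → q ℚ.< 0ℚ → 0ℚ ℚ.< ℚ.- q
0<-neg = ℚₚ.neg-antimono-<

neg-neg : ∀ q → ℚ.- (ℚ.- q) ≡ q
neg-neg = solve-∀ ℚ-ring

∣∣<⇒< : ∀ {q r} → ∣ q ∣ ℚ.< r → q ℚ.< r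
∣∣<⇒< {q} {r} h with ℚₚ.∣p∣≡p∨∣p∣≡-p q
... | inj₁ e = subst (ℚ._< r) e h
... | inj₂ e with ℚₚ.<-cmp q 0ℚ
...   | tri< q<0 _ _ = ℚₚ.<-≤-trans q<0 (ℚₚ.≤-trans (ℚₚ.0≤∣p∣ q) (ℚₚ.<⇒≤ h))
...   | tri≈ _ refl _ = h
...   | tri> _ _ 0<q = subst (ℚ._< r) (ℚₚ.0≤p⇒∣p∣≡p (ℚₚ.<⇒≤ 0<q)) h

<⇒∣∣< : ∀ {q r} → q ℚ.< r → ℚ.- q ℚ.< r → ∣ q ∣ ℚ.< r
<⇒∣∣< {q} {r} h k with ℚₚ.∣p∣≡p∨∣p∣≡-p q
... | inj₁ e = subst (ℚ._< r) (sym e) h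
... | inj₂ e = subst (ℚ._< r) (sym e) k

-- Both sides use repeated addition only, so the equation can be read inside any set closed under
-- addition.
denominator-cleared : ∀ {q} → 0ℚ ℚ.< q → ∃₂ λ d m → suc d · q ≡ suc m · 1ℚ
denominator-cleared {mkℚ +[1+ m ] d cop} _ = d , m , ℚₚ.toℚᵘ-injective (begin
  toℚᵘ (suc d · mkℚ +[1+ m ] d cop)   ≈⟨ toℚᵘ-· (suc d) (mkℚ +[1+ m ] d cop) ⟩
  mkℚᵘ (+ suc d ℤ.* +[1+ m ]) d       ≈⟨ *≡* (swap (+ suc d) +[1+ m ]) ⟩
  mkℚᵘ (+ suc m ℤ.* + 1) 0            ≈⟨ toℚᵘ-· (suc m) 1ℚ ⟨
  toℚᵘ (suc m · 1ℚ)                   ∎)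
  where
  open ℚᵘₚ.≃-Reasoning
  swap : ∀ i j → i ℤ.* j ℤ.* + 1 ≡ j ℤ.* + 1 ℤ.* i
  swap = ℤ-Solver.solve-∀
  add-numerators : ∀ n i D → (i ℤ.* D ℤ.+ n ℤ.* i ℤ.* D) ℤ.* D ≡ ((+ 1 ℤ.+ n) ℤ.* i) ℤ.* (D ℤ.* D)
  add-numerators = ℤ-Solver.solve-∀
  toℚᵘ-· : ∀ n q → toℚᵘ (n · q) ℚᵘ.≃ mkℚᵘ (+ n ℤ.* ℚ.numerator q) (ℚ.denominator-1 q)
  toℚᵘ-· zero    q@record{} = *≡* refl
  toℚᵘ-· (suc n) q@record{} = begin
    toℚᵘ (q ℚ.+ n · q)              ≈⟨ ℚₚ.toℚᵘ-homo-+ q (n · q) ⟩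
    toℚᵘ q ℚᵘ.+ toℚᵘ (n · q)        ≈⟨ ℚᵘₚ.+-congʳ (toℚᵘ q) (toℚᵘ-· n q) ⟩
    toℚᵘ q ℚᵘ.+ mkℚᵘ (+ n ℤ.* ℚ.numerator q) (ℚ.denominator-1 q)
      ≈⟨ *≡* (add-numerators (+ n) (ℚ.numerator q) (ℚ.denominator q)) ⟩
    mkℚᵘ (+ suc n ℤ.* ℚ.numerator q) (ℚ.denominator-1 q) ∎
denominator-cleared {mkℚ (+ 0) d cop} (ℚ.*<* (ℤ.+<+ ()))
denominator-cleared {mkℚ -[1+ n ] d cop} (ℚ.*<* ())

·-nonNeg : ∀ n {q} → 0ℚ ℚ.< q → 0ℚ ℚ.≤ n · q
·-nonNeg zero    _   = ℚₚ.≤-refl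
·-nonNeg (suc n) 0<q = ℚₚ.<⇒≤ (ℚₚ.+-mono-<-≤ 0<q (·-nonNeg n 0<q))

·-assocʳ : ∀ n p q → n · p ℚ.* q ≡ n · (p ℚ.* q)
·-assocʳ zero    p q = ℚₚ.*-zeroˡ q
·-assocʳ (suc n) p q =
  trans (ℚₚ.*-distribʳ-+ q p (n · p)) (cong (p ℚ.* q ℚ.+_) (·-assocʳ n p q))

-- For r > 0, clearing the denominator of r / g gives (d + 1) r = (m + 1) g, hence r ≤ (m + 1) g <
-- (m + 2) g.
archimedean : ∀ {g} r → 0ℚ ℚ.< g → ∃ λ n → r ℚ.< suc n · g
archimedean {g} r 0<g with ℚₚ.<-cmp 0ℚ r
... | tri≈ _ refl _ = 0 , subst (0ℚ ℚ.<_) (sym (ℚₚ.+-identityʳ g)) 0<g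
... | tri> _ _ r<0 = 0 , subst (r ℚ.<_) (sym (ℚₚ.+-identityʳ g)) (ℚₚ.<-trans r<0 0<g)
... | tri< 0<r _ _ =
  let i , 0<i , gi≡1 = reciprocal 0<g
      d , m , eq     = denominator-cleared (*-pos 0<r 0<i)
      clear : suc d · r ≡ suc m · g
      clear = let open ≡-Reasoning in begin
        suc d · r                     ≡⟨ cong (suc d ·_) (reciprocal-cancel g i r gi≡1) ⟨
        suc d · (i ℚ.* (g ℚ.* r))     ≡⟨ cong (suc d ·_) (swap g r i) ⟩
        suc d · (r ℚ.* i ℚ.* g)       ≡⟨ ·-assocʳ (suc d) (r ℚ.* i) g ⟨
        suc d · (r ℚ.* i) ℚ.* g       ≡⟨ cong (ℚ._* g) eq ⟩
        suc m · 1ℚ ℚ.* g              ≡⟨ ·-assocʳ (suc m) 1ℚ g ⟩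
        suc m · (1ℚ ℚ.* g)            ≡⟨ cong (suc m ·_) (ℚₚ.*-identityˡ g) ⟩
        suc m · g                     ∎
  in suc m , (let open ℚₚ.≤-Reasoning in begin-strict
    r                  ≡⟨ ℚₚ.+-identityʳ r ⟨
    r ℚ.+ 0ℚ           ≤⟨ ℚₚ.+-monoʳ-≤ r (·-nonNeg d 0<r) ⟩
    suc d · r          ≡⟨ clear ⟩
    suc m · g          ≡⟨ ℚₚ.+-identityˡ (suc m · g) ⟨
    0ℚ ℚ.+ suc m · g   <⟨ ℚₚ.+-monoˡ-< (suc m · g) 0<g ⟩
    suc (suc m) · g    ∎)
  where
  swap : ∀ g r i → i ℚ.* (g ℚ.* r) ≡ r ℚ.* i ℚ.* g
  swap = solve-∀ ℚ-ring

-- Real numbers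

infix 4 _≗_

_≗_ : ℝ → ℝ → Set
x ≗ y = ∀ n → seq x n ≡ seq y n

Pos : ℝ → Set
Pos x = 0ℝ < x

pos : ∀ {x} g → 0ℚ ℚ.< g → (∃ λ N → ∀ n → N ℕ.≤ n → g ℚ.< seq x n) → Pos x
pos {x} g 0<g (N , h) = mk< g 0<g
  (N , λ n n≥ → subst (g ℚ.<_) (sym (ℚₚ.+-identityʳ (seq x n))) (h n n≥))

pos⁻¹ : ∀ {x} → Pos x → ∃ λ g → 0ℚ ℚ.< g × ∃ λ N → ∀ n → N ℕ.≤ n → g ℚ.< seq x n
pos⁻¹ {x} (mk< g 0<g (N , h)) =
  g , 0<g , N , λ n n≥ → subst (g ℚ.<_) (ℚₚ.+-identityʳ (seq x n)) (h n n≥)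

Pos-resp-≗ : ∀ {x y} → x ≗ y → Pos x → Pos y
Pos-resp-≗ eq p =
  let g , 0<g , N , h = pos⁻¹ p in pos g 0<g (N , λ n n≥ → subst (g ℚ.<_) (eq n) (h n n≥))

Pos-+ : ∀ {x y} → Pos x → Pos y → Pos (x + y)
Pos-+ p q =
  let g , 0<g , M , hx = pos⁻¹ p
      k , 0<k , N , hy = pos⁻¹ q
  in pos (g ℚ.+ k) (+-pos 0<g 0<k) (M ℕ.⊔ N , λ n n≥ →
       ℚₚ.+-mono-< (hx n (ℕₚ.m⊔n≤o⇒m≤o M N n≥)) (hy n (ℕₚ.m⊔n≤o⇒n≤o M N n≥)))

Pos-* : ∀ {x y} → Pos x → Pos y → Pos (x * y)
Pos-* {x} {y} p q =
  let g , 0<g , M , hx = pos⁻¹ p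
      k , 0<k , N , hy = pos⁻¹ q
  in pos (g ℚ.* k) (*-pos 0<g 0<k) (M ℕ.⊔ N , λ n n≥ →
       let gx = hx n (ℕₚ.m⊔n≤o⇒m≤o M N n≥)
           ky = hy n (ℕₚ.m⊔n≤o⇒n≤o M N n≥)
       in ℚₚ.<-trans
            (ℚₚ.*-monoʳ-<-pos g {{ℚ.positive 0<g}} ky)
            (ℚₚ.*-monoˡ-<-pos (seq y n) {{ℚ.positive (ℚₚ.<-trans 0<k ky)}} gx))

Pos-fromℚ : ∀ {q} → 0ℚ ℚ.< q → Pos (fromℚ q)
Pos-fromℚ {q} 0<q = let g , 0<g , g<q = ℚₚ.<-dense 0<q in pos g 0<g (0 , λ _ _ → g<q)

Pos-fromℚ⁻¹ : ∀ {q} → Pos (fromℚ q) → 0ℚ ℚ.< q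
Pos-fromℚ⁻¹ p = let g , 0<g , N , h = pos⁻¹ p in ℚₚ.<-trans 0<g (h N ℕₚ.≤-refl)

-- Half of the known gap is subtracted; the other half remains as a gap for the difference.
positive-gap : ∀ {x} → Pos x → ∃ λ g → 0ℚ ℚ.< g × Pos (x + - fromℚ g)
positive-gap {x} p =
  let g , 0<g , N , h = pos⁻¹ p
  in ½ ℚ.* g , ½*-pos 0<g , pos (½ ℚ.* g) (½*-pos 0<g) (N , λ n n≥ →
       0<-⇒< (subst (0ℚ ℚ.<_)
         (trans (cong (λ h → seq x n ℚ.- h) (sym (halves g))) (rearrange (seq x n) (½ ℚ.* g)))
         (<⇒0<- (h n n≥))))
  where
  rearrange : ∀ x h → x ℚ.- (h ℚ.+ h) ≡ x ℚ.+ ℚ.- h ℚ.- h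
  rearrange = solve-∀ ℚ-ring

approximation : ∀ x ε → 0ℚ ℚ.< ε →
  ∃ λ q → Pos (x + - fromℚ q) × Pos (fromℚ (q ℚ.+ ε) + - x)
approximation x ε 0<ε =
  -- Here δ = ε/4. The tail of x stays within δ of x_N, hence more than δ above q = x_N - 2δ and
  -- more than δ below q + ε = x_N + 2δ.
  let η      = ½ ℚ.* ε
      δ      = ½ ℚ.* η
      0<δ    = ½*-pos (½*-pos 0<ε)
      N , h  = cauchy x δ 0<δ
      δ+δ≡η  = halves η
      4δ≡ε   = trans (cong₂ ℚ._+_ δ+δ≡η δ+δ≡η) (halves ε)
      q      = seq x N ℚ.- (δ ℚ.+ δ)
  in q
   , pos δ 0<δ (N , λ n n≥ → 0<-⇒< (subst (0ℚ ℚ.<_) (below (seq x N) (seq x n) δ)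
       (<⇒0<- (∣∣<⇒< (h N n ℕₚ.≤-refl n≥)))))
   , pos δ 0<δ (N , λ n n≥ → 0<-⇒< (subst (0ℚ ℚ.<_)
       (trans (above (seq x N) (seq x n) δ)
              (cong (λ e → q ℚ.+ e ℚ.+ ℚ.- seq x n ℚ.- δ) 4δ≡ε))
       (<⇒0<- (∣∣<⇒< (h n N n≥ ℕₚ.≤-refl)))))
  where
  below : ∀ a b d → d ℚ.- (a ℚ.- b) ≡ b ℚ.+ ℚ.- (a ℚ.- (d ℚ.+ d)) ℚ.- d
  below = solve-∀ ℚ-ring
  above : ∀ a b d →
    d ℚ.- (b ℚ.- a) ≡ a ℚ.- (d ℚ.+ d) ℚ.+ ((d ℚ.+ d) ℚ.+ (d ℚ.+ d)) ℚ.+ ℚ.- b ℚ.- d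
  above = solve-∀ ℚ-ring

bounded : ∀ x → ∃ λ B → 0ℚ ℚ.< B × ∃ λ N → ∀ n → N ℕ.≤ n → ∣ seq x n ∣ ℚ.< B
bounded x =
  let N , h = cauchy x 1ℚ (ℚₚ.positive⁻¹ 1ℚ)
  in 1ℚ ℚ.+ ∣ seq x N ∣
   , ℚₚ.+-mono-<-≤ (ℚₚ.positive⁻¹ 1ℚ) (ℚₚ.0≤∣p∣ (seq x N))
   , N , λ n n≥ → (let open ℚₚ.≤-Reasoning in begin-strict
       ∣ seq x n ∣                                ≡⟨ cong ∣_∣ (split (seq x n) (seq x N)) ⟩
       ∣ (seq x n ℚ.- seq x N) ℚ.+ seq x N ∣      ≤⟨ ℚₚ.∣p+q∣≤∣p∣+∣q∣ (seq x n ℚ.- seq x N) (seq x N) ⟩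
       ∣ seq x n ℚ.- seq x N ∣ ℚ.+ ∣ seq x N ∣    <⟨ ℚₚ.+-monoˡ-< ∣ seq x N ∣ (h n N n≥ ℕₚ.≤-refl) ⟩
       1ℚ ℚ.+ ∣ seq x N ∣                         ∎)
  where
  split : ∀ a b → a ≡ (a ℚ.- b) ℚ.+ b
  split = solve-∀ ℚ-ring

upper-bound : ∀ x → ∃ λ B → 0ℚ ℚ.< B × Pos (fromℚ B + - x)
upper-bound x =
  let B , 0<B , N , h = bounded x
  in B ℚ.+ 1ℚ , +-pos 0<B (ℚₚ.positive⁻¹ 1ℚ) , pos 1ℚ (ℚₚ.positive⁻¹ 1ℚ) (N , λ n n≥ →
       0<-⇒< (subst (0ℚ ℚ.<_) (rearrange B 1ℚ (seq x n)) (<⇒0<- (∣∣<⇒< (h n n≥)))))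
  where
  rearrange : ∀ b i a → b ℚ.- a ≡ b ℚ.+ i ℚ.+ ℚ.- a ℚ.- i
  rearrange = solve-∀ ℚ-ring

lower-bound : ∀ x → ∃ λ B → 0ℚ ℚ.< B × Pos (x + fromℚ B)
lower-bound x =
  let B , 0<B , p = upper-bound (- x)
  in B , 0<B , Pos-resp-≗ (λ n → rearrange (seq x n) B) p
  where
  rearrange : ∀ a b → b ℚ.+ ℚ.- (ℚ.- a) ≡ a ℚ.+ b
  rearrange = solve-∀ ℚ-ring

-- Equality of real numbers

≗⇒≈ : ∀ {x y} → x ≗ y → x ≈ y
≗⇒≈ {x} {y} eq = mk≈ λ ε 0<ε → 0 , λ n _ →
  subst (λ z → ∣ z ∣ ℚ.< ε)
    (sym (trans (cong (ℚ._- seq y n) (eq n)) (ℚₚ.+-inverseʳ (seq y n)))) 0<ε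

≈-sym : ∀ {x y} → x ≈ y → y ≈ x
≈-sym {x} {y} x≈y = mk≈ λ ε 0<ε →
  let N , h = close x≈y ε 0<ε
  in N , λ n n≥ → subst (ℚ._< ε)
       (trans (sym (ℚₚ.∣-p∣≡∣p∣ (seq x n ℚ.- seq y n))) (cong ∣_∣ (flip (seq x n) (seq y n)))) (h n n≥)
  where
  flip : ∀ a b → ℚ.- (a ℚ.- b) ≡ b ℚ.- a
  flip = solve-∀ ℚ-ring

≈-trans : ∀ {x y z} → x ≈ y → y ≈ z → x ≈ z
≈-trans {x} {y} {z} x≈y y≈z = mk≈ λ ε 0<ε →
  let M , h = close x≈y (½ ℚ.* ε) (½*-pos 0<ε)
      N , k = close y≈z (½ ℚ.* ε) (½*-pos 0<ε)
  in M ℕ.⊔ N , λ n n≥ → (let open ℚₚ.≤-Reasoning in begin-strict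
       ∣ seq x n ℚ.- seq z n ∣
         ≡⟨ cong ∣_∣ (split (seq x n) (seq y n) (seq z n)) ⟩
       ∣ (seq x n ℚ.- seq y n) ℚ.+ (seq y n ℚ.- seq z n) ∣
         ≤⟨ ℚₚ.∣p+q∣≤∣p∣+∣q∣ (seq x n ℚ.- seq y n) (seq y n ℚ.- seq z n) ⟩
       ∣ seq x n ℚ.- seq y n ∣ ℚ.+ ∣ seq y n ℚ.- seq z n ∣
         <⟨ ℚₚ.+-mono-< (h n (ℕₚ.m⊔n≤o⇒m≤o M N n≥)) (k n (ℕₚ.m⊔n≤o⇒n≤o M N n≥)) ⟩
       ½ ℚ.* ε ℚ.+ ½ ℚ.* ε
         ≡⟨ halves ε ⟩
       ε ∎)
  where
  split : ∀ a b c → a ℚ.- c ≡ (a ℚ.- b) ℚ.+ (b ℚ.- c)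
  split = solve-∀ ℚ-ring

+-congʳ : ∀ {x y} z → x ≈ y → x + z ≈ y + z
+-congʳ {x} {y} z x≈y = mk≈ λ ε 0<ε →
  let N , h = close x≈y ε 0<ε
  in N , λ n n≥ →
       subst (λ d → ∣ d ∣ ℚ.< ε) (cancel (seq x n) (seq y n) (seq z n)) (h n n≥)
  where
  cancel : ∀ a b c → a ℚ.- b ≡ (a ℚ.+ c) ℚ.- (b ℚ.+ c)
  cancel = solve-∀ ℚ-ring

neg-cong : ∀ {x y} → x ≈ y → - x ≈ - y
neg-cong {x} {y} x≈y = mk≈ λ ε 0<ε →
  let N , h = close (≈-sym x≈y) ε 0<ε
  in N , λ n n≥ → subst (λ d → ∣ d ∣ ℚ.< ε) (flip (seq x n) (seq y n)) (h n n≥)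
  where
  flip : ∀ a b → b ℚ.- a ≡ ℚ.- a ℚ.- (ℚ.- b)
  flip = solve-∀ ℚ-ring

*-zeroˡ-≈ : ∀ {x} y → x ≈ 0ℝ → x * y ≈ 0ℝ
*-zeroˡ-≈ {x} y x≈0 = mk≈ λ ε 0<ε →
  let B , 0<B , M , hy = bounded y
      r , 0<r , Br≡1   = reciprocal 0<B
      N , hx           = close x≈0 (r ℚ.* ε) (*-pos 0<r 0<ε)
  in M ℕ.⊔ N , λ n n≥ →
       let a  = seq x n
           b  = seq y n
           b< = hy n (ℕₚ.m⊔n≤o⇒m≤o M N n≥)
           a< = subst (λ z → ∣ z ∣ ℚ.< r ℚ.* ε) (ℚₚ.+-identityʳ a) (hx n (ℕₚ.m⊔n≤o⇒n≤o M N n≥))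
       in (let open ℚₚ.≤-Reasoning in begin-strict
         ∣ a ℚ.* b ℚ.- 0ℚ ∣      ≡⟨ cong ∣_∣ (ℚₚ.+-identityʳ (a ℚ.* b)) ⟩
         ∣ a ℚ.* b ∣             ≡⟨ ℚₚ.∣p*q∣≡∣p∣*∣q∣ a b ⟩
         ∣ a ∣ ℚ.* ∣ b ∣         ≤⟨ ℚₚ.*-monoˡ-≤-nonNeg ∣ a ∣ {{ℚ.nonNegative (ℚₚ.0≤∣p∣ a)}} (ℚₚ.<⇒≤ b<) ⟩
         ∣ a ∣ ℚ.* B             <⟨ ℚₚ.*-monoˡ-<-pos B {{ℚ.positive 0<B}} a< ⟩
         r ℚ.* ε ℚ.* B           ≡⟨ swap r ε B ⟩
         r ℚ.* (B ℚ.* ε)         ≡⟨ reciprocal-cancel B r ε Br≡1 ⟩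
         ε                       ∎)
  where
  swap : ∀ a b c → a ℚ.* b ℚ.* c ≡ a ℚ.* (c ℚ.* b)
  swap = solve-∀ ℚ-ring

-- A single term x_n ≥ ε beyond the Cauchy index for ε/2 would keep all later terms above ε/2 and
-- make x positive.
eventually-<-of-¬Pos : ∀ x ε → 0ℚ ℚ.< ε → ¬ Pos x →
  ∃ λ N → ∀ n → N ℕ.≤ n → seq x n ℚ.< ε
eventually-<-of-¬Pos x ε 0<ε ¬p =
  let N , h = cauchy x (½ ℚ.* ε) (½*-pos 0<ε)
  in N , λ n n≥ → ℚₚ.≰⇒> λ ε≤xₙ →
       ¬p (pos (½ ℚ.* ε) (½*-pos 0<ε) (N , λ m m≥ → (let open ℚₚ.≤-Reasoning in begin-strict
         ½ ℚ.* ε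
           ≡⟨ split (½ ℚ.* ε) ⟩
         (½ ℚ.* ε ℚ.+ ½ ℚ.* ε) ℚ.- ½ ℚ.* ε
           ≡⟨ cong (λ e → e ℚ.- ½ ℚ.* ε) (halves ε) ⟩
         ε ℚ.- ½ ℚ.* ε
           ≤⟨ ℚₚ.+-monoˡ-≤ (ℚ.- (½ ℚ.* ε)) ε≤xₙ ⟩
         seq x n ℚ.- ½ ℚ.* ε
           <⟨ 0<-⇒< (subst (0ℚ ℚ.<_) (rearrange (seq x n) (seq x m) (½ ℚ.* ε))
                (<⇒0<- (∣∣<⇒< (h n m n≥ m≥)))) ⟩
         seq x m ∎)))
  where
  split : ∀ h → h ≡ (h ℚ.+ h) ℚ.- h
  split = solve-∀ ℚ-ring
  rearrange : ∀ a b h → h ℚ.- (a ℚ.- b) ≡ b ℚ.- (a ℚ.- h)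
  rearrange = solve-∀ ℚ-ring

-- This stands in for trichotomy: the sign of a Cauchy real is not decidable, but refuting both
-- signs bounds the tail on both sides.
≈0-of-¬Pos : ∀ {x} → ¬ Pos x → ¬ Pos (- x) → x ≈ 0ℝ
≈0-of-¬Pos {x} ¬x ¬-x = mk≈ λ ε 0<ε →
  let M , h = eventually-<-of-¬Pos x ε 0<ε ¬x
      N , k = eventually-<-of-¬Pos (- x) ε 0<ε ¬-x
  in M ℕ.⊔ N , λ n n≥ →
       subst (λ z → ∣ z ∣ ℚ.< ε) (sym (ℚₚ.+-identityʳ (seq x n)))
         (<⇒∣∣< (h n (ℕₚ.m⊔n≤o⇒m≤o M N n≥)) (k n (ℕₚ.m⊔n≤o⇒n≤o M N n≥)))

fromℚ≉0 : ∀ {q} → q ≢ 0ℚ → ¬ (fromℚ q ≈ 0ℝ)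
fromℚ≉0 {q} q≢0 q≈0 =
  let N , h = close q≈0 ∣ q ∣ 0<∣q∣
  in ℚₚ.<-irrefl (cong ∣_∣ (ℚₚ.+-identityʳ q)) (h N ℕₚ.≤-refl)
  where
  0<∣q∣ : 0ℚ ℚ.< ∣ q ∣
  0<∣q∣ = ℚₚ.≰⇒> λ ∣q∣≤0 → q≢0 (ℚₚ.∣p∣≡0⇒p≡0 q (ℚₚ.≤-antisym ∣q∣≤0 (ℚₚ.0≤∣p∣ q)))

-- The approximation q is replaced by the larger of q and a positive rational g < x; if g is larger,
-- then x < q + ε < g + ε.
approximation⁺ : ∀ {x} ε → Pos x → 0ℚ ℚ.< ε →
  ∃ λ q → 0ℚ ℚ.< q × Pos (x + - fromℚ q) × Pos (fromℚ (q ℚ.+ ε) + - x)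
approximation⁺ {x} ε 0<x 0<ε = choose (positive-gap 0<x) (approximation x ε 0<ε)
  where
  rearrange : ∀ q e g x → (q ℚ.+ e ℚ.+ ℚ.- x) ℚ.+ (g ℚ.- q) ≡ g ℚ.+ e ℚ.+ ℚ.- x
  rearrange = solve-∀ ℚ-ring
  choose : (∃ λ g → 0ℚ ℚ.< g × Pos (x + - fromℚ g)) →
    (∃ λ q → Pos (x + - fromℚ q) × Pos (fromℚ (q ℚ.+ ε) + - x)) →
    ∃ λ q → 0ℚ ℚ.< q × Pos (x + - fromℚ q) × Pos (fromℚ (q ℚ.+ ε) + - x)
  choose (g , 0<g , g<x) (q , q<x , x<q+ε) with g ℚₚ.≤? q
  ... | yes g≤q = q , ℚₚ.<-≤-trans 0<g g≤q , q<x , x<q+ε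
  ... | no  g≰q = g , 0<g , g<x , Pos-resp-≗ (λ n → rearrange q ε g (seq x n))
                    (Pos-+ x<q+ε (Pos-fromℚ (<⇒0<- (ℚₚ.≰⇒> g≰q))))

-- Polynomials

-- The product rule along Horner's scheme. This form matches the recursion of `eval`, whereas
-- `deriv` provides the shorter polynomial needed for induction.
evalDeriv : Poly → ℝ → ℝ
evalDeriv []      x = 0ℝ
evalDeriv (c ∷ p) x = eval p x + x * evalDeriv p x

-- For q = k this is the polynomial X¹⁻ᵏ · d/dX (Xᵏ p).
shiftedDeriv : ℚ → Poly → Poly
shiftedDeriv q []      = []
shiftedDeriv q (c ∷ p) = q ℚ.* c ∷ shiftedDeriv (q ℚ.+ 1ℚ) p

deriv : Poly → Poly
deriv []      = []
deriv (c ∷ p) = shiftedDeriv 1ℚ p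

-- For q = k this is X¹⁻ᵏ (Xᵏ p)′ = k p + X p′, evaluated at x.
eval-shiftedDeriv : ∀ q p x → eval (shiftedDeriv q p) x ≗ fromℚ q * eval p x + x * evalDeriv p x
eval-shiftedDeriv q []      x n = sym (cong₂ ℚ._+_ (ℚₚ.*-zeroʳ q) (ℚₚ.*-zeroʳ (seq x n)))
eval-shiftedDeriv q (c ∷ p) x n =
  trans (cong (λ e → q ℚ.* c ℚ.+ seq x n ℚ.* e) (eval-shiftedDeriv (q ℚ.+ 1ℚ) p x n))
        (rearrange q c (seq x n) (seq (eval p x) n) (seq (evalDeriv p x) n))
  where
  rearrange : ∀ q c x e d →
    q ℚ.* c ℚ.+ x ℚ.* ((q ℚ.+ 1ℚ) ℚ.* e ℚ.+ x ℚ.* d) ≡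
    q ℚ.* (c ℚ.+ x ℚ.* e) ℚ.+ x ℚ.* (e ℚ.+ x ℚ.* d)
  rearrange = solve-∀ ℚ-ring

eval-deriv : ∀ p x → eval (deriv p) x ≗ evalDeriv p x
eval-deriv []      x n = refl
eval-deriv (c ∷ p) x n = trans (eval-shiftedDeriv 1ℚ p x n)
  (cong (ℚ._+ seq x n ℚ.* seq (evalDeriv p x) n) (ℚₚ.*-identityˡ (seq (eval p x) n)))

length-shiftedDeriv : ∀ q p → length (shiftedDeriv q p) ≡ length p
length-shiftedDeriv q []      = refl
length-shiftedDeriv q (c ∷ p) = cong suc (length-shiftedDeriv (q ℚ.+ 1ℚ) p)

-- Characteristic zero enters here: the coefficients are multiplied by q, q + 1, ..., all of them
-- positive.
shiftedDeriv-nonZero : ∀ {q p} → 0ℚ ℚ.< q → NonZeroPoly p → NonZeroPoly (shiftedDeriv q p)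
shiftedDeriv-nonZero {q} 0<q (here {c} c≢0) = here λ qc≡0 →
  let r , _ , qr≡1 = reciprocal 0<q
  in c≢0 (trans (sym (reciprocal-cancel q r c qr≡1)) (trans (cong (r ℚ.*_) qc≡0) (ℚₚ.*-zeroʳ r)))
shiftedDeriv-nonZero 0<q (there h) =
  there (shiftedDeriv-nonZero (+-pos 0<q (ℚₚ.positive⁻¹ 1ℚ)) h)

eval-zeroPoly : ∀ p x → ¬ NonZeroPoly p → eval p x ≗ 0ℝ
eval-zeroPoly []      x h n = refl
eval-zeroPoly (c ∷ p) x h n with c ℚₚ.≟ 0ℚ
... | no  c≢0  = ⊥-elim (h (here c≢0))
... | yes refl = trans (cong (λ e → 0ℚ ℚ.+ seq x n ℚ.* e) (eval-zeroPoly p x (λ k → h (there k)) n))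
                       (trans (ℚₚ.+-identityˡ (seq x n ℚ.* 0ℚ)) (ℚₚ.*-zeroʳ (seq x n)))

-- Induction on the length. If some higher coefficient is nonzero, the derivative is a shorter
-- nonzero polynomial with the same root; otherwise p takes the nonzero value c everywhere.
eval≉0-of-deriv-closed : ∀ x → (∀ p → eval p x ≈ 0ℝ → eval (deriv p) x ≈ 0ℝ) →
  ∀ p → NonZeroPoly p → ¬ (eval p x ≈ 0ℝ)
eval≉0-of-deriv-closed x closed p = go (length p) p refl
  where
  go : ∀ n p → length p ≡ n → NonZeroPoly p → ¬ (eval p x ≈ 0ℝ)
  go (suc n) (c ∷ p) eq h root with any? (λ c → ¬? (c ℚₚ.≟ 0ℚ)) p
  ... | yes p≢0 = go n (shiftedDeriv 1ℚ p)
        (trans (length-shiftedDeriv 1ℚ p) (ℕₚ.suc-injective eq))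
        (shiftedDeriv-nonZero (ℚₚ.positive⁻¹ 1ℚ) p≢0) (closed (c ∷ p) root)
  go (suc n) (c ∷ p) eq (there p≢0) root | no p≡0 = p≡0 p≢0
  go (suc n) (c ∷ p) eq (here c≢0) root  | no p≡0 =
    fromℚ≉0 c≢0 (≈-trans (≗⇒≈ λ n → sym
      (trans (cong (λ e → c ℚ.+ seq x n ℚ.* e) (eval-zeroPoly p x p≡0 n))
        (trans (cong (c ℚ.+_) (ℚₚ.*-zeroʳ (seq x n))) (ℚₚ.+-identityʳ c)))) root)

-- Splittings of ℚ(a)⁺

rational∈ : ∀ {a} q → fromℚ q ∈ℚ⟨ a ⟩
rational∈ q = rat q (≗⇒≈ λ _ → refl)

+-∈ : ∀ {a x y} → x ∈ℚ⟨ a ⟩ → y ∈ℚ⟨ a ⟩ → (x + y) ∈ℚ⟨ a ⟩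
+-∈ x∈ y∈ = add x∈ y∈ (≗⇒≈ λ _ → refl)

*-∈ : ∀ {a x y} → x ∈ℚ⟨ a ⟩ → y ∈ℚ⟨ a ⟩ → (x * y) ∈ℚ⟨ a ⟩
*-∈ x∈ y∈ = mul x∈ y∈ (≗⇒≈ λ _ → refl)

neg-∈ : ∀ {a x} → x ∈ℚ⟨ a ⟩ → (- x) ∈ℚ⟨ a ⟩
neg-∈ x∈ = neg x∈ (≗⇒≈ λ _ → refl)

∈-resp-≈ : ∀ {a x y} → x ≈ y → x ∈ℚ⟨ a ⟩ → y ∈ℚ⟨ a ⟩
∈-resp-≈ {x = x} x≈y x∈ = add x∈ (rational∈ 0ℚ)
  (≈-trans (≈-sym x≈y) (≗⇒≈ λ n → sym (ℚₚ.+-identityʳ (seq x n))))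

-- Only conditions on a single set are collected here, so that H₁ and H₂ can later exchange the
-- roles of P and M.
record IsPart {ℓ : Level} (a : ℝ) (H : Pred ℝ ℓ) : Set ℓ where
  field
    resp     : ∀ {x y} → x ≈ y → H x → H y
    member   : ∀ {x} → H x → x ∈ℚ⟨ a ⟩
    positive : ∀ {x} → H x → Pos x
    +-closed : ClosedUnder _+_ H
    *-closed : ClosedUnder _*_ H

  resp-≗ : ∀ {x y} → x ≗ y → H x → H y
  resp-≗ eq = resp (≗⇒≈ eq)

-- For a part H of a splitting, whether x + q ∈ H does not depend on the rational q,
-- as long as x + q is positive.
record Shifted {ℓ : Level} (H : Pred ℝ ℓ) (x : ℝ) : Set ℓ where
  constructor shifted
  field
    shift : ℚ
    at    : H (x + fromℚ shift)

-- Instantiated with P and with M, this yields the cones U and L. The two closure properties are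
-- parameters because their proofs differ for the two parts.
module Shift {ℓ : Level} {a : ℝ} {H : Pred ℝ ℓ} (isPart : IsPart a H)
  (scale : ∀ {q x} → 0ℚ ℚ.< q → H x → H (fromℚ q * x))
  (translate : ∀ {x} q → H x → Pos (x + fromℚ q) → H (x + fromℚ q)) where

  open IsPart isPart

  shifted-resp : ∀ {x y} → x ≈ y → Shifted H x → Shifted H y
  shifted-resp x≈y (shifted N h) = shifted N (resp (+-congʳ (fromℚ N) x≈y) h)

  shifted-resp-≗ : ∀ {x y} → x ≗ y → Shifted H x → Shifted H y
  shifted-resp-≗ eq = shifted-resp (≗⇒≈ eq)

  shifted-of : ∀ {x} → H x → Shifted H x
  shifted-of {x} h = shifted 0ℚ (resp-≗ (λ n → sym (ℚₚ.+-identityʳ (seq x n))) h)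

  shifted-at : ∀ {x} → Shifted H x → ∀ q → Pos (x + fromℚ q) → H (x + fromℚ q)
  shifted-at {x} (shifted N h) q 0<x+q = resp-≗ eq
    (translate (q ℚ.- N) h (Pos-resp-≗ (λ n → sym (eq n)) 0<x+q))
    where
    rearrange : ∀ x N q → (x ℚ.+ N) ℚ.+ (q ℚ.- N) ≡ x ℚ.+ q
    rearrange = solve-∀ ℚ-ring
    eq : ∀ n → (seq x n ℚ.+ N) ℚ.+ (q ℚ.- N) ≡ seq x n ℚ.+ q
    eq n = rearrange (seq x n) N q

  shifted-member : ∀ {x} → Shifted H x → x ∈ℚ⟨ a ⟩
  shifted-member {x} (shifted N h) = ∈-resp-≈ (≗⇒≈ (λ n → cancel (seq x n) N))
    (+-∈ (member h) (rational∈ (ℚ.- N)))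
    where
    cancel : ∀ x N → x ℚ.+ N ℚ.+ ℚ.- N ≡ x
    cancel = solve-∀ ℚ-ring

  shifted-+ : ∀ {x y} → Shifted H x → Shifted H y → Shifted H (x + y)
  shifted-+ {x} {y} (shifted M h) (shifted N k) = shifted (M ℚ.+ N)
    (resp-≗ (λ n → rearrange (seq x n) (seq y n) M N) (+-closed h k))
    where
    rearrange : ∀ x y M N → (x ℚ.+ M) ℚ.+ (y ℚ.+ N) ≡ x ℚ.+ y ℚ.+ (M ℚ.+ N)
    rearrange = solve-∀ ℚ-ring

  shifted-scale : ∀ {q x} → 0ℚ ℚ.< q → Shifted H x → Shifted H (fromℚ q * x)
  shifted-scale {q} {x} 0<q (shifted N h) = shifted (q ℚ.* N)
    (resp-≗ (λ n → ℚₚ.*-distribˡ-+ q (seq x n) N) (scale 0<q h))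

  shifted-translate : ∀ {x} q → Shifted H x → Shifted H (x + fromℚ q)
  shifted-translate {x} q (shifted N h) = shifted (N ℚ.- q)
    (resp-≗ (λ n → rearrange (seq x n) q N) h)
    where
    rearrange : ∀ x q N → x ℚ.+ N ≡ x ℚ.+ q ℚ.+ (N ℚ.- q)
    rearrange = solve-∀ ℚ-ring

  -- Products are available only for positive translates; the constant term qr of (x + q)(y + r) is
  -- absorbed by the shift.
  shifted-* : ∀ {x y} q r → Shifted H x → Shifted H y → Pos (x + fromℚ q) → Pos (y + fromℚ r) →
    Shifted H (x * y + (fromℚ q * y + fromℚ r * x))
  shifted-* {x} {y} q r hx hy 0<x+q 0<y+r = shifted (q ℚ.* r)
    (resp-≗ (λ n → expand (seq x n) (seq y n) q r)
      (*-closed (shifted-at hx q 0<x+q) (shifted-at hy r 0<y+r)))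
    where
    expand : ∀ x y q r →
      (x ℚ.+ q) ℚ.* (y ℚ.+ r) ≡ x ℚ.* y ℚ.+ (q ℚ.* y ℚ.+ r ℚ.* x) ℚ.+ q ℚ.* r
    expand = solve-∀ ℚ-ring

module Splitting {ℓ : Level} {a : ℝ} {P M : Pred ℝ ℓ}
  (P-isPart : IsPart a P) (M-isPart : IsPart a M)
  (split : ∀ {x} → x ∈ℚ⟨ a ⟩ → Pos x → P x ⊎ M x)
  (disjoint : ∀ {x} → P x → ¬ M x)
  (1∈P : P 1ℝ) where

  module P = IsPart P-isPart
  module M = IsPart M-isPart

  -- Rational scaling and translation of the two parts

  multiple : ∀ {H : Pred ℝ ℓ} {q} → IsPart a H → H (fromℚ q) → ∀ n → H (fromℚ (suc n · q))
  multiple {q = q} isPart h zero    =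
    IsPart.resp-≗ isPart (λ _ → sym (ℚₚ.+-identityʳ q)) h
  multiple {q = q} isPart h (suc n) =
    IsPart.resp-≗ isPart (λ _ → refl) (IsPart.+-closed isPart h (multiple isPart h n))

  -- If q were in M, so would be a multiple of q that is a positive integer; but positive integers
  -- are sums of ones and lie in P.
  rational∈P : ∀ {q} → 0ℚ ℚ.< q → P (fromℚ q)
  rational∈P {q} 0<q = fromInj₁ (λ q∈M →
    let d , m , eq = denominator-cleared 0<q
    in ⊥-elim (disjoint (multiple P-isPart 1∈P m)
         (subst (λ r → M (fromℚ r)) eq (multiple M-isPart q∈M d))))
    (split (rational∈ q) (Pos-fromℚ 0<q))

  P-scale : ∀ {q x} → 0ℚ ℚ.< q → P x → P (fromℚ q * x)
  P-scale 0<q = P.*-closed (rational∈P 0<q)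

  -- If qx were in P, scaling it back by 1/q would put x in P.
  M-scale : ∀ {q x} → 0ℚ ℚ.< q → M x → M (fromℚ q * x)
  M-scale {q} {x} 0<q x∈M = fromInj₂ (λ qx∈P →
    let r , 0<r , qr≡1 = reciprocal 0<q
    in ⊥-elim (disjoint
         (P.resp-≗ (λ n → reciprocal-cancel q r (seq x n) qr≡1) (P-scale 0<r qx∈P)) x∈M))
    (split (*-∈ (rational∈ q) (M.member x∈M)) (Pos-* (Pos-fromℚ 0<q) (M.positive x∈M)))

  -- If x + q were in P, adding the positive rational r - q, also in P, would put x + r in P.
  M-down : ∀ {x q r} → M (x + fromℚ r) → q ℚ.< r → x ∈ℚ⟨ a ⟩ → Pos (x + fromℚ q) → M (x + fromℚ q)
  M-down {x} {q} {r} x+r∈M q<r x∈ 0<x+q = fromInj₂ (λ x+q∈P →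
    ⊥-elim (disjoint
      (P.resp-≗ (λ n → rearrange (seq x n) q r) (P.+-closed x+q∈P (rational∈P (<⇒0<- q<r))))
      x+r∈M))
    (split (+-∈ x∈ (rational∈ q)) 0<x+q)
    where
    rearrange : ∀ x q r → x ℚ.+ q ℚ.+ (r ℚ.- q) ≡ x ℚ.+ r
    rearrange = solve-∀ ℚ-ring

  -- (x + 2q)² = x² + 4q(x + q), where the right-hand side is in M.
  M-double : ∀ {x q} → 0ℚ ℚ.< q → M x → M (x + fromℚ q) → M (x + fromℚ (q ℚ.+ q))
  M-double {x} {q} 0<q x∈M x+q∈M = fromInj₂ (λ x+2q∈P →
    ⊥-elim (disjoint (P.*-closed x+2q∈P x+2q∈P)
      (M.resp-≗ (λ n → expand (seq x n) q)
        (M.+-closed (M.*-closed x∈M x∈M)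
          (M-scale (+-pos (+-pos 0<q 0<q) (+-pos 0<q 0<q)) x+q∈M)))))
    (split (+-∈ (M.member x∈M) (rational∈ (q ℚ.+ q)))
           (Pos-+ (M.positive x∈M) (Pos-fromℚ (+-pos 0<q 0<q))))
    where
    expand : ∀ x q → x ℚ.* x ℚ.+ ((q ℚ.+ q) ℚ.+ (q ℚ.+ q)) ℚ.* (x ℚ.+ q)
                   ≡ (x ℚ.+ (q ℚ.+ q)) ℚ.* (x ℚ.+ (q ℚ.+ q))
    expand = solve-∀ ℚ-ring

  -- Two consecutive terms of the progression are carried along, since `M-double` obtains the next
  -- term from the last two.
  M-multiples : ∀ {x q} → 0ℚ ℚ.< q → M x → M (x + fromℚ q) →
    ∀ n → M (x + fromℚ (n · q)) × M (x + fromℚ (suc n · q))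
  M-multiples {x} {q} 0<q x∈M x+q∈M zero =
      M.resp-≗ (λ n → sym (ℚₚ.+-identityʳ (seq x n))) x∈M
    , M.resp-≗ (λ n → cong (seq x n ℚ.+_) (sym (ℚₚ.+-identityʳ q))) x+q∈M
  M-multiples {x} {q} 0<q x∈M x+q∈M (suc n) =
    let h , k = M-multiples 0<q x∈M x+q∈M n
    in k , M.resp-≗ (λ i → two (seq x i) (n · q) q)
             (M-double 0<q h (M.resp-≗ (λ i → one (seq x i) (n · q) q) k))
    where
    one : ∀ x r q → x ℚ.+ (q ℚ.+ r) ≡ x ℚ.+ r ℚ.+ q
    one = solve-∀ ℚ-ring
    two : ∀ x r q → x ℚ.+ r ℚ.+ (q ℚ.+ q) ≡ x ℚ.+ (q ℚ.+ (q ℚ.+ r))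
    two = solve-∀ ℚ-ring

  M-translate : ∀ {x} q → M x → Pos (x + fromℚ q) → M (x + fromℚ q)
  M-translate {x} q x∈M 0<x+q =
    -- Going down by a positive rational g < x gives y = x - g, so that y and y + g are both in M.
    -- From there the progression climbs past x + q, and `M-down` returns to x + q.
    let g , 0<g , 0<x-g = positive-gap (M.positive x∈M)
        y = x + fromℚ (ℚ.- g)
        x≗y+g : x ≗ (y + fromℚ g)
        x≗y+g i = sym (cancel (seq x i) g)
        y∈M = M-down {r = 0ℚ} (M.resp-≗ (λ i → sym (ℚₚ.+-identityʳ (seq x i))) x∈M)
                (ℚₚ.neg-antimono-< 0<g) (M.member x∈M)
                (Pos-resp-≗ (λ _ → refl) 0<x-g)
        n , lt = archimedean (q ℚ.+ g) 0<g
        y+ng∈M = proj₁ (M-multiples 0<g y∈M (M.resp-≗ x≗y+g x∈M) (suc n))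
        eq : (y + fromℚ (q ℚ.+ g)) ≗ (x + fromℚ q)
        eq i = rearrange (seq x i) q g
    in M.resp-≗ eq (M-down y+ng∈M lt (M.member y∈M) (Pos-resp-≗ (λ i → sym (eq i)) 0<x+q))
    where
    cancel : ∀ x g → x ℚ.+ ℚ.- g ℚ.+ g ≡ x
    cancel = solve-∀ ℚ-ring
    rearrange : ∀ x q g → x ℚ.+ ℚ.- g ℚ.+ (q ℚ.+ g) ≡ x ℚ.+ q
    rearrange = solve-∀ ℚ-ring

  P-translate : ∀ {x} q → P x → Pos (x + fromℚ q) → P (x + fromℚ q)
  P-translate {x} q x∈P 0<x+q = fromInj₁ (λ x+q∈M →
    ⊥-elim (disjoint x∈P
      (M.resp-≗ cancelled (M-translate (ℚ.- q) x+q∈M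
        (Pos-resp-≗ (λ n → sym (cancelled n)) (P.positive x∈P))))))
    (split (+-∈ (P.member x∈P) (rational∈ q)) 0<x+q)
    where
    cancel : ∀ x q → x ℚ.+ q ℚ.+ ℚ.- q ≡ x
    cancel = solve-∀ ℚ-ring
    cancelled : (x + fromℚ q + fromℚ (ℚ.- q)) ≗ x
    cancelled n = cancel (seq x n) q

  -- The complementary cones U and L in ℚ(a)

  module U = Shift P-isPart P-scale P-translate
  module L = Shift M-isPart M-scale M-translate

  classify : ∀ {x} → x ∈ℚ⟨ a ⟩ → Shifted P x ⊎ Shifted M x
  classify {x} x∈ =
    let N , _ , 0<x+N = lower-bound x
    in Sum.map (shifted N) (shifted N) (split (+-∈ x∈ (rational∈ N)) 0<x+N)

  L∩U≡∅ : ∀ {x} → Shifted M x → ¬ Shifted P x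
  L∩U≡∅ {x} l u = let N , _ , 0<x+N = lower-bound x
              in disjoint (U.shifted-at u N 0<x+N) (L.shifted-at l N 0<x+N)

  rational∈U : ∀ q → Shifted P (fromℚ q)
  rational∈U q = shifted (1ℚ ℚ.- q) (P.resp-≗ (λ _ → cancel 1ℚ q) 1∈P)
    where
    cancel : ∀ i q → i ≡ q ℚ.+ (i ℚ.- q)
    cancel = solve-∀ ℚ-ring

  -- If x and -x were both in L, their sum 0 would be too, but rationals lie in U.
  -L⊆U : ∀ {x} → Shifted M x → Shifted P (- x)
  -L⊆U {x} l = fromInj₁ (λ -l → ⊥-elim (L∩U≡∅
      (L.shifted-resp-≗ (λ n → ℚₚ.+-inverseʳ (seq x n)) (L.shifted-+ l -l)) (rational∈U 0ℚ)))
    (classify (neg-∈ (L.shifted-member l)))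

  -- Think of a ℚ-linear functional f with f(1) = 0 that is nonnegative on P and
  -- nonpositive on M: Slope x y σ stands for f(y) = σ f(x).
  record LowerSlope (x y σ : ℝ) : Set ℓ where
    constructor lowerSlope
    field
      below : ∀ s → Pos (σ + - fromℚ s) → Shifted M (y + - (fromℚ s * x))

  open LowerSlope

  -- A cut for the ratio f(y) / f(x). With f(x) < 0, the condition f(y) ≤ s f(x) for all rationals s
  -- < σ bounds the ratio below by σ. An upper bound is a lower bound for -y, so both halves share
  -- their lemmas.
  record Slope (x y σ : ℝ) : Set ℓ where
    constructor slope
    field
      member : y ∈ℚ⟨ a ⟩
      lower  : LowerSlope x y σ
      upper  : LowerSlope x (- y) (- σ)

  open Slope

  -- Linearity of slopes

  module _ {x : ℝ} where

    lowerSlope-resp-≗ : ∀ {y z σ τ} → y ≗ z → σ ≗ τ → LowerSlope x y σ → LowerSlope x z τ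
    lowerSlope-resp-≗ {y} {z} {σ} {τ} y≗z σ≗τ h = lowerSlope λ s p →
      L.shifted-resp (+-congʳ (- (fromℚ s * x)) (≗⇒≈ y≗z))
        (below h s (Pos-resp-≗ {τ + - fromℚ s} {σ + - fromℚ s} (λ n → cong (λ r → r ℚ.+ ℚ.- s) (sym (σ≗τ n))) p))

    lowerSlope-resp-≈ : ∀ {y z σ} → y ≈ z → LowerSlope x y σ → LowerSlope x z σ
    lowerSlope-resp-≈ y≈z h = lowerSlope λ s p →
      L.shifted-resp (+-congʳ (- (fromℚ s * x)) y≈z) (below h s p)

    lowerSlope-+ : ∀ {y z σ τ} → LowerSlope x y σ → LowerSlope x z τ →
      LowerSlope x (y + z) (σ + τ)
    lowerSlope-+ {y} {z} {σ} {τ} h k = lowerSlope λ s p →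
      -- The bound s is split as q + (s - q). Taking q < σ closer to σ than the gap between s and σ
      -- + τ forces s - q < τ.
      let g , 0<g , gap     = positive-gap p
          q , q<σ , σ<q+g   = approximation σ g 0<g
      in L.shifted-resp-≗ (λ n → combine (seq y n) (seq z n) (seq x n) s q)
           (L.shifted-+ (below h q q<σ)
             (below k (s ℚ.- q)
               (Pos-resp-≗ (λ n → margin (seq σ n) (seq τ n) s q g) (Pos-+ gap σ<q+g))))
      where
      combine : ∀ y z x s q → (y ℚ.+ ℚ.- (q ℚ.* x)) ℚ.+ (z ℚ.+ ℚ.- ((s ℚ.- q) ℚ.* x))
                            ≡ y ℚ.+ z ℚ.+ ℚ.- (s ℚ.* x)
      combine = solve-∀ ℚ-ring
      margin : ∀ σ τ s q g → (σ ℚ.+ τ ℚ.+ ℚ.- s ℚ.+ ℚ.- g) ℚ.+ (q ℚ.+ g ℚ.+ ℚ.- σ)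
                           ≡ τ ℚ.+ ℚ.- (s ℚ.- q)
      margin = solve-∀ ℚ-ring

    lowerSlope-half : ∀ {y σ} → LowerSlope x (y + y) (σ + σ) → LowerSlope x y σ
    lowerSlope-half {y} {σ} h = lowerSlope λ s p →
      let y-sx = y + - (fromℚ s * x)
      in L-half {y-sx} (L.shifted-resp-≗ (λ n → collect (seq y n) (seq x n) s)
           (below h (s ℚ.+ s) (Pos-resp-≗ (λ n → double (seq σ n) s) (Pos-+ p p))))
      where
      L-half : ∀ {z} → Shifted M (z + z) → Shifted M z
      L-half {z} h = L.shifted-resp-≗ (λ n → half-double (seq z n))
        (L.shifted-scale {½} {z + z} (ℚₚ.positive⁻¹ ½) h)
        where
        half-double : ∀ z → ½ ℚ.* (z ℚ.+ z) ≡ z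
        half-double z = trans (ℚₚ.*-distribˡ-+ ½ z z) (halves z)
      collect : ∀ y x s → y ℚ.+ y ℚ.+ ℚ.- ((s ℚ.+ s) ℚ.* x)
                        ≡ (y ℚ.+ ℚ.- (s ℚ.* x)) ℚ.+ (y ℚ.+ ℚ.- (s ℚ.* x))
      collect = solve-∀ ℚ-ring
      double : ∀ σ s → (σ ℚ.+ ℚ.- s) ℚ.+ (σ ℚ.+ ℚ.- s) ≡ σ ℚ.+ σ ℚ.+ ℚ.- (s ℚ.+ s)
      double = solve-∀ ℚ-ring

    slope-resp-≗ : ∀ {y z σ τ} → y ≗ z → σ ≗ τ → Slope x y σ → Slope x z τ
    slope-resp-≗ y≗z σ≗τ h = slope
      (∈-resp-≈ (≗⇒≈ y≗z) (member h))
      (lowerSlope-resp-≗ y≗z σ≗τ (lower h))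
      (lowerSlope-resp-≗ (λ n → cong ℚ.-_ (y≗z n)) (λ n → cong ℚ.-_ (σ≗τ n)) (upper h))

    slope-resp-≈ : ∀ {y z σ} → y ≈ z → Slope x y σ → Slope x z σ
    slope-resp-≈ y≈z h = slope
      (∈-resp-≈ y≈z (member h))
      (lowerSlope-resp-≈ y≈z (lower h))
      (lowerSlope-resp-≈ (neg-cong y≈z) (upper h))

    slope-neg : ∀ {y σ} → Slope x y σ → Slope x (- y) (- σ)
    slope-neg {y} {σ} h = slope (neg-∈ (member h)) (upper h)
      (lowerSlope-resp-≗ (λ n → sym (neg-neg (seq y n))) (λ n → sym (neg-neg (seq σ n))) (lower h))

    slope-+ : ∀ {y z σ τ} → Slope x y σ → Slope x z τ → Slope x (y + z) (σ + τ)
    slope-+ {y} {z} {σ} {τ} h k = slope (+-∈ (member h) (member k))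
      (lowerSlope-+ (lower h) (lower k))
      (lowerSlope-resp-≗
        (λ n → sym (ℚₚ.neg-distrib-+ (seq y n) (seq z n)))
        (λ n → sym (ℚₚ.neg-distrib-+ (seq σ n) (seq τ n)))
        (lowerSlope-+ (upper h) (upper k)))

    slope-half : ∀ {y σ} → y ∈ℚ⟨ a ⟩ → Slope x (y + y) (σ + σ) → Slope x y σ
    slope-half {y} {σ} y∈ h = slope y∈ (lowerSlope-half (lower h))
      (lowerSlope-half (lowerSlope-resp-≗
        (λ n → ℚₚ.neg-distrib-+ (seq y n) (seq y n))
        (λ n → ℚₚ.neg-distrib-+ (seq σ n) (seq σ n)) (upper h)))

    -- For a rational 0 < g < τ, both q - gx and gx lie in L, so q would lie in L as well as in U.
    lowerSlope-rational⇒¬Pos : ∀ {q τ} → LowerSlope x (fromℚ q) τ → Shifted M x → ¬ Pos τ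
    lowerSlope-rational⇒¬Pos {q} h x∈L 0<τ =
      let g , 0<g , gap = positive-gap 0<τ
      in L∩U≡∅ (L.shifted-resp-≗ (λ n → cancel q (g ℚ.* seq x n))
                 (L.shifted-+ (below h g gap) (L.shifted-scale 0<g x∈L)))
               (rational∈U q)
      where
      cancel : ∀ q r → q ℚ.+ ℚ.- r ℚ.+ r ≡ q
      cancel = solve-∀ ℚ-ring

    slope-rational⇒≈0 : ∀ {q τ} → Slope x (fromℚ q) τ → Shifted M x → τ ≈ 0ℝ
    slope-rational⇒≈0 h x∈L = ≈0-of-¬Pos
      (lowerSlope-rational⇒¬Pos (lower h) x∈L)
      (lowerSlope-rational⇒¬Pos
        (lowerSlope-resp-≗ (λ _ → refl) (λ _ → refl) (upper h)) x∈L)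

    -- Slopes relative to an element of M: the derivation rules

    module _ (x∈M : M x) where

      x∈L : Shifted M x
      x∈L = L.shifted-of x∈M

      -- For s < k, subtracting sx leaves a positive multiple of x, up to a rational translation.
      lowerSlope-affine : ∀ k q → LowerSlope x (fromℚ k * x + fromℚ q) (fromℚ k)
      lowerSlope-affine k q = lowerSlope λ s p →
        L.shifted-resp-≗ (λ n → collect k s q (seq x n))
          (L.shifted-translate q
            (L.shifted-scale (Pos-fromℚ⁻¹ (Pos-resp-≗ {y = fromℚ (k ℚ.- s)} (λ _ → refl) p)) x∈L))
        where
        collect : ∀ k s q x → (k ℚ.- s) ℚ.* x ℚ.+ q ≡ k ℚ.* x ℚ.+ q ℚ.+ ℚ.- (s ℚ.* x)
        collect = solve-∀ ℚ-ring

      slope-affine : ∀ k q → Slope x (fromℚ k * x + fromℚ q) (fromℚ k)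
      slope-affine k q = slope (+-∈ (*-∈ (rational∈ k) (M.member x∈M)) (rational∈ q))
        (lowerSlope-affine k q)
        (lowerSlope-resp-≗ (λ n → negate k q (seq x n)) (λ _ → refl)
          (lowerSlope-affine (ℚ.- k) (ℚ.- q)))
        where
        negate : ∀ k q x → ℚ.- k ℚ.* x ℚ.+ ℚ.- q ≡ ℚ.- (k ℚ.* x ℚ.+ q)
        negate = solve-∀ ℚ-ring

      slope-rational : ∀ q → Slope x (fromℚ q) 0ℝ
      slope-rational q = slope-resp-≗
        (λ n → trans (cong (ℚ._+ q) (ℚₚ.*-zeroˡ (seq x n))) (ℚₚ.+-identityˡ q))
        (λ _ → refl) (slope-affine 0ℚ q)

      slope-self : Slope x x 1ℝ
      slope-self = slope-resp-≗
        (λ n → trans (ℚₚ.+-identityʳ _) (ℚₚ.*-identityˡ (seq x n)))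
        (λ _ → refl) (slope-affine 1ℚ 0ℚ)

      -- A positive σ puts y in L (take s = 0), and a positive y allows division by 2q for rationals
      -- 0 < q < y.
      slope-square⁺ : ∀ {y σ} → Pos y → Pos σ → Slope x y σ → Slope x (y * y) (y * σ + y * σ)
      slope-square⁺ {y} {σ} 0<y 0<σ h =
        slope (*-∈ (member h) (member h)) (lowerSlope lo) (lowerSlope hi)
        where
        y∈L : Shifted M y
        y∈L = L.shifted-resp-≗
          (λ n → trans (cong (λ e → seq y n ℚ.+ ℚ.- e) (ℚₚ.*-zeroˡ (seq x n))) (ℚₚ.+-identityʳ (seq y n)))
          (below (lower h) 0ℚ (Pos-resp-≗ (λ n → sym (ℚₚ.+-identityʳ (seq σ n))) 0<σ))

        -- Replacing y by a rational within ε changes 2yσ by at most 2Bε, where B bounds σ; ε is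
        -- chosen to make 2Bε a gap of z.
        tolerance : ∀ {z} → Pos z →
          ∃₂ λ B ε → 0ℚ ℚ.< B × 0ℚ ℚ.< ε × Pos (fromℚ B + - σ) × Pos (z + - fromℚ ((B ℚ.+ B) ℚ.* ε))
        tolerance {z} 0<z =
          let g , 0<g , gap     = positive-gap 0<z
              B , 0<B , σ<B     = upper-bound σ
              r , 0<r , 2Br≡1   = reciprocal (+-pos 0<B 0<B)
          in B , r ℚ.* g , 0<B , *-pos 0<r 0<g , σ<B
           , Pos-resp-≗ (λ n → cong (λ e → seq z n ℚ.+ ℚ.- e)
               (trans (sym (reciprocal-cancel (B ℚ.+ B) r g 2Br≡1)) (swap r (B ℚ.+ B) g))) gap
          where
          swap : ∀ r b g → r ℚ.* (b ℚ.* g) ≡ b ℚ.* (r ℚ.* g)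
          swap = solve-∀ ℚ-ring

        distribute : ∀ r q σ s → r ℚ.* (q ℚ.* σ ℚ.+ ℚ.- s) ≡ r ℚ.* (q ℚ.* σ) ℚ.+ ℚ.- (r ℚ.* s)
        distribute = solve-∀ ℚ-ring

        -- The square of y - q lies in M for rationals q < y near y.
        lo : ∀ s → Pos (y * σ + y * σ + - fromℚ s) → Shifted M (y * y + - (fromℚ s * x))
        lo s p =
          let B , ε , 0<B , 0<ε , σ<B , gap = tolerance p
              q , 0<q , q<y , y<q+ε         = approximation⁺ ε 0<y 0<ε
              r , 0<r , 2qr≡1               = reciprocal (+-pos 0<q 0<q)
              d = Pos-* y<q+ε 0<σ
              e = Pos-* (Pos-fromℚ 0<ε) σ<B
              -- 2qσ - s is the sum of 2yσ - s - 2Bε, 2(q + ε - y)σ and 2ε(B - σ), all positive.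
              -- Division by 2q then gives σ > rs with rs = s/(2q).
              2qσ>s : Pos (fromℚ (q ℚ.+ q) * σ + - fromℚ s)
              2qσ>s = Pos-resp-≗ (λ n → estimate (seq y n) (seq σ n) s q ε B)
                        (Pos-+ gap (Pos-+ (Pos-+ d d) (Pos-+ e e)))
              σ>rs : Pos (σ + - fromℚ (r ℚ.* s))
              σ>rs = Pos-resp-≗ (λ n → trans (distribute r (q ℚ.+ q) (seq σ n) s)
                         (cong (λ e → e ℚ.+ ℚ.- (r ℚ.* s)) (reciprocal-cancel (q ℚ.+ q) r (seq σ n) 2qr≡1)))
                       (Pos-* (Pos-fromℚ 0<r) 2qσ>s)
              0<y-q : Pos (y + fromℚ (ℚ.- q))
              0<y-q = Pos-resp-≗ (λ _ → refl) q<y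
          -- Up to a constant, (y - q)² is y² - 2qy; adding 2q(y - rsx) leaves y² - sx.
          in L.shifted-resp-≗
               (λ n → trans (expand (seq y n) (seq x n) q r s)
                  (cong (λ e → seq y n ℚ.* seq y n ℚ.+ ℚ.- (e ℚ.* seq x n))
                    (reciprocal-cancel (q ℚ.+ q) r s 2qr≡1)))
               (L.shifted-+ (L.shifted-* (ℚ.- q) (ℚ.- q) y∈L y∈L 0<y-q 0<y-q)
                 (L.shifted-scale (+-pos 0<q 0<q) (below (lower h) (r ℚ.* s) σ>rs)))
          where
          estimate : ∀ y σ s q ε B →
            (y ℚ.* σ ℚ.+ y ℚ.* σ ℚ.+ ℚ.- s ℚ.+ ℚ.- ((B ℚ.+ B) ℚ.* ε)) ℚ.+
            (((q ℚ.+ ε ℚ.+ ℚ.- y) ℚ.* σ ℚ.+ (q ℚ.+ ε ℚ.+ ℚ.- y) ℚ.* σ) ℚ.+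
             (ε ℚ.* (B ℚ.+ ℚ.- σ) ℚ.+ ε ℚ.* (B ℚ.+ ℚ.- σ)))
            ≡ (q ℚ.+ q) ℚ.* σ ℚ.+ ℚ.- s
          estimate = solve-∀ ℚ-ring
          expand : ∀ y x q r s →
            (y ℚ.* y ℚ.+ (ℚ.- q ℚ.* y ℚ.+ ℚ.- q ℚ.* y)) ℚ.+
            (q ℚ.+ q) ℚ.* (y ℚ.+ ℚ.- (r ℚ.* s ℚ.* x))
            ≡ y ℚ.* y ℚ.+ ℚ.- (r ℚ.* ((q ℚ.+ q) ℚ.* s) ℚ.* x)
          expand = solve-∀ ℚ-ring

        -- The square of N - y lies in P for rationals N > y near y.
        hi : ∀ s → Pos (- (y * σ + y * σ) + - fromℚ s) → Shifted M (- (y * y) + - (fromℚ s * x))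
        hi s p =
          let B , ε , 0<B , 0<ε , σ<B , gap = tolerance p
              q , 0<q , q<y , y<q+ε         = approximation⁺ ε 0<y 0<ε
              N                             = q ℚ.+ ε
              0<2N                          = +-pos (+-pos 0<q 0<ε) (+-pos 0<q 0<ε)
              r , 0<r , 2Nr≡1               = reciprocal 0<2N
              d = Pos-* q<y 0<σ
              e = Pos-* (Pos-fromℚ 0<ε) σ<B
              2Nσ<-s : Pos (fromℚ (N ℚ.+ N) * - σ + - fromℚ s)
              2Nσ<-s = Pos-resp-≗ (λ n → estimate (seq y n) (seq σ n) s q ε B)
                         (Pos-+ gap (Pos-+ (Pos-+ d d) (Pos-+ e e)))
              -σ>rs : Pos (- σ + - fromℚ (r ℚ.* s))
              -σ>rs = Pos-resp-≗ (λ n → trans (distribute r (N ℚ.+ N) (ℚ.- seq σ n) s)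
                         (cong (λ e → e ℚ.+ ℚ.- (r ℚ.* s)) (reciprocal-cancel (N ℚ.+ N) r (ℚ.- seq σ n) 2Nr≡1)))
                       (Pos-* (Pos-fromℚ 0<r) 2Nσ<-s)
              -y∈U : Shifted P (- y)
              -y∈U = -L⊆U y∈L
              0<-y+N : Pos (- y + fromℚ N)
              0<-y+N = Pos-resp-≗ (λ n → ℚₚ.+-comm N (ℚ.- seq y n)) y<q+ε
              2N[-y-rsx]∈L = L.shifted-scale 0<2N (below (upper h) (r ℚ.* s) -σ>rs)
              [N-y]²∈U     = U.shifted-* N N -y∈U -y∈U 0<-y+N 0<-y+N
          -- If -y² - sx were in U, adding (N - y)², which is y² - 2Ny up to a constant, would put
          -- -2Ny - sx in U. But this equals 2N(-y - rsx), which lies in L.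
          in fromInj₂ (λ u → ⊥-elim (L∩U≡∅ {fromℚ (N ℚ.+ N) * - y + - (fromℚ s * x)}
               (L.shifted-resp-≗
                 (λ n → trans (collect (seq y n) (seq x n) N r s)
                   (cong (λ e → (N ℚ.+ N) ℚ.* ℚ.- seq y n ℚ.+ ℚ.- (e ℚ.* seq x n))
                     (reciprocal-cancel (N ℚ.+ N) r s 2Nr≡1)))
                 2N[-y-rsx]∈L)
               (U.shifted-resp-≗ (λ n → expand (seq y n) (seq x n) N s) (U.shifted-+ [N-y]²∈U u))))
             (classify (+-∈ (neg-∈ (*-∈ (member h) (member h)))
               (neg-∈ (*-∈ (rational∈ s) (M.member x∈M)))))
          where
          estimate : ∀ y σ s q ε B →
            (ℚ.- (y ℚ.* σ ℚ.+ y ℚ.* σ) ℚ.+ ℚ.- s ℚ.+ ℚ.- ((B ℚ.+ B) ℚ.* ε)) ℚ.+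
            (((y ℚ.+ ℚ.- q) ℚ.* σ ℚ.+ (y ℚ.+ ℚ.- q) ℚ.* σ) ℚ.+
             (ε ℚ.* (B ℚ.+ ℚ.- σ) ℚ.+ ε ℚ.* (B ℚ.+ ℚ.- σ)))
            ≡ (q ℚ.+ ε ℚ.+ (q ℚ.+ ε)) ℚ.* ℚ.- σ ℚ.+ ℚ.- s
          estimate = solve-∀ ℚ-ring
          collect : ∀ y x N r s →
            (N ℚ.+ N) ℚ.* (ℚ.- y ℚ.+ ℚ.- (r ℚ.* s ℚ.* x))
            ≡ (N ℚ.+ N) ℚ.* ℚ.- y ℚ.+ ℚ.- (r ℚ.* ((N ℚ.+ N) ℚ.* s) ℚ.* x)
          collect = solve-∀ ℚ-ring
          expand : ∀ y x N s →
            (ℚ.- y ℚ.* ℚ.- y ℚ.+ (N ℚ.* ℚ.- y ℚ.+ N ℚ.* ℚ.- y)) ℚ.+ (ℚ.- (y ℚ.* y) ℚ.+ ℚ.- (s ℚ.* x))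
            ≡ (N ℚ.+ N) ℚ.* ℚ.- y ℚ.+ ℚ.- (s ℚ.* x)
          expand = solve-∀ ℚ-ring

      -- y² = 2 (y + z)² - (y + 2z)² + 2z² for an affine function z of x making all three
      -- bases positive and of positive slope.
      slope-square : ∀ {y σ} → Slope x y σ → Slope x (y * y) (y * σ + y * σ)
      slope-square {y} {σ} h =
        -- The coefficient k makes the slope σ + k positive, and b makes y + b positive; kx > 0 then
        -- keeps y + z positive.
        let k , 0<k , 0<σ+k = lower-bound σ
            b , 0<b , 0<y+b = lower-bound y
            z       = fromℚ k * x + fromℚ b
            z-slope = slope-affine k b
            0<kx    = Pos-* (Pos-fromℚ 0<k) (M.positive x∈M)
            0<z     = Pos-+ 0<kx (Pos-fromℚ 0<b)
            0<y+z : Pos (y + z)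
            0<y+z   = Pos-resp-≗ (λ n → swap (seq y n) b (k ℚ.* seq x n)) (Pos-+ 0<y+b 0<kx)
            A = slope-square⁺ 0<y+z 0<σ+k (slope-+ h z-slope)
            B = slope-square⁺ (Pos-+ 0<y+z 0<z) (Pos-+ 0<σ+k (Pos-fromℚ 0<k))
                  (slope-+ (slope-+ h z-slope) z-slope)
            C = slope-square⁺ 0<z (Pos-fromℚ 0<k) z-slope
        in slope-resp-≗
             (λ n → value (seq y n) (k ℚ.* seq x n ℚ.+ b))
             (λ n → derivative (seq y n) (seq σ n) (k ℚ.* seq x n ℚ.+ b) k)
             (slope-+ (slope-+ (slope-+ A A) (slope-neg B)) (slope-+ C C))
        where
        swap : ∀ y b kx → y ℚ.+ b ℚ.+ kx ≡ y ℚ.+ (kx ℚ.+ b)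
        swap = solve-∀ ℚ-ring
        value : ∀ y z →
          (y ℚ.+ z) ℚ.* (y ℚ.+ z) ℚ.+ (y ℚ.+ z) ℚ.* (y ℚ.+ z) ℚ.+
          ℚ.- ((y ℚ.+ z ℚ.+ z) ℚ.* (y ℚ.+ z ℚ.+ z)) ℚ.+ (z ℚ.* z ℚ.+ z ℚ.* z) ≡ y ℚ.* y
        value = solve-∀ ℚ-ring
        derivative : ∀ y σ z k →
          ((y ℚ.+ z) ℚ.* (σ ℚ.+ k) ℚ.+ (y ℚ.+ z) ℚ.* (σ ℚ.+ k)) ℚ.+
          ((y ℚ.+ z) ℚ.* (σ ℚ.+ k) ℚ.+ (y ℚ.+ z) ℚ.* (σ ℚ.+ k)) ℚ.+
          ℚ.- ((y ℚ.+ z ℚ.+ z) ℚ.* (σ ℚ.+ k ℚ.+ k) ℚ.+ (y ℚ.+ z ℚ.+ z) ℚ.* (σ ℚ.+ k ℚ.+ k)) ℚ.+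
          ((z ℚ.* k ℚ.+ z ℚ.* k) ℚ.+ (z ℚ.* k ℚ.+ z ℚ.* k))
          ≡ y ℚ.* σ ℚ.+ y ℚ.* σ
        derivative = solve-∀ ℚ-ring

      -- Polarization: 2yz = (y + z)² - (y² + z²), followed by halving.
      slope-* : ∀ {y z σ τ} → Slope x y σ → Slope x z τ → Slope x (y * z) (y * τ + z * σ)
      slope-* {y} {z} {σ} {τ} h k = slope-half (*-∈ (member h) (member k))
        (slope-resp-≗
          (λ n → value (seq y n) (seq z n))
          (λ n → derivative (seq y n) (seq z n) (seq σ n) (seq τ n))
          (slope-+ (slope-square (slope-+ h k))
            (slope-neg (slope-+ (slope-square h) (slope-square k)))))
        where
        value : ∀ y z → (y ℚ.+ z) ℚ.* (y ℚ.+ z) ℚ.+ ℚ.- (y ℚ.* y ℚ.+ z ℚ.* z) ≡ y ℚ.* z ℚ.+ y ℚ.* z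
        value = solve-∀ ℚ-ring
        derivative : ∀ y z σ τ →
          (y ℚ.+ z) ℚ.* (σ ℚ.+ τ) ℚ.+ (y ℚ.+ z) ℚ.* (σ ℚ.+ τ) ℚ.+
          ℚ.- ((y ℚ.* σ ℚ.+ y ℚ.* σ) ℚ.+ (z ℚ.* τ ℚ.+ z ℚ.* τ))
          ≡ (y ℚ.* τ ℚ.+ z ℚ.* σ) ℚ.+ (y ℚ.* τ ℚ.+ z ℚ.* σ)
        derivative = solve-∀ ℚ-ring

      slope-eval : ∀ {y σ} p → Slope x y σ → Slope x (eval p y) (evalDeriv p y * σ)
      slope-eval {y} {σ} []      h =
        slope-resp-≗ (λ _ → refl) (λ n → sym (ℚₚ.*-zeroˡ (seq σ n))) (slope-rational 0ℚ)
      slope-eval {y} {σ} (c ∷ p) h =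
        slope-resp-≗ (λ _ → refl)
          (λ n → rearrange (seq y n) (seq σ n) (seq (eval p y) n) (seq (evalDeriv p y) n))
          (slope-+ (slope-rational c) (slope-* h (slope-eval p h)))
        where
        rearrange : ∀ y σ e d → 0ℚ ℚ.+ (y ℚ.* (d ℚ.* σ) ℚ.+ e ℚ.* σ) ≡ (e ℚ.+ y ℚ.* d) ℚ.* σ
        rearrange = solve-∀ ℚ-ring

      -- Differentiating p(y) = 0 gives p′(y) σ = 0, hence p′(y) = 0, and so on down to a
      -- nonzero constant.
      algebraic-slope≢±1 : ∀ {y ρ} → ρ ℚ.* ρ ≡ 1ℚ → AlgebraicOverℚ y → ¬ Slope x y (fromℚ ρ)
      algebraic-slope≢±1 {y} {ρ} ρ²≡1 (p , p≢0 , root) h =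
        eval≉0-of-deriv-closed y closed p p≢0 root
        where
        cancel : ∀ d ρ → d ℚ.* ρ ℚ.* ρ ≡ d ℚ.* (ρ ℚ.* ρ)
        cancel = solve-∀ ℚ-ring
        closed : ∀ p → eval p y ≈ 0ℝ → eval (deriv p) y ≈ 0ℝ
        -- As ρ² = 1, a second multiplication by ρ recovers p′(y) from p′(y) ρ ≈ 0.
        closed p root = ≈-trans
          (≗⇒≈ λ n → let d = seq (evalDeriv p y) n in
            trans (eval-deriv p y n) (sym (trans (cancel d ρ)
              (trans (cong (d ℚ.*_) ρ²≡1) (ℚₚ.*-identityʳ d)))))
          (*-zeroˡ-≈ (fromℚ ρ)
            (slope-rational⇒≈0 (slope-resp-≈ root (slope-eval p h)) x∈L))

      -- The product rule gives yz the slope y · 0 + z · 1 = z, while 1 has slope 0; hence z ≈ 0 and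
      -- yz cannot be 1.
      slope1∙slope0≉1 : ∀ {y z} → Slope x y 1ℝ → Slope x z 0ℝ → ¬ (y * z ≈ 1ℝ)
      slope1∙slope0≉1 {y} {z} h k yz≈1 = fromℚ≉0 1≢0
        (≈-trans (≈-sym yz≈1) (≈-trans (≗⇒≈ (λ n → ℚₚ.*-comm (seq y n) (seq z n))) (*-zeroˡ-≈ y z≈0)))
        where
        1≢0 : 1ℚ ≢ 0ℚ
        1≢0 ()
        rearrange : ∀ y z → y ℚ.* 0ℚ ℚ.+ z ℚ.* 1ℚ ≡ z
        rearrange = solve-∀ ℚ-ring
        z≈0 : z ≈ 0ℝ
        z≈0 = ≈-trans (≗⇒≈ (λ n → sym (rearrange (seq y n) (seq z n))))
          (slope-rational⇒≈0 (slope-resp-≈ yz≈1 (slope-* h k)) x∈L)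

  -- The kernel U ∩ -U and its closure under the field operations

  record Kernel (x : ℝ) : Set ℓ where
    constructor kernel
    field
      x∈U  : Shifted P x
      -x∈U : Shifted P (- x)

  -- Unlike `Slope`, `Kernel` refers to no element of M. One is found only within a refutation, as a
  -- translate of the x or -x assumed to be in L.
  kernel-of : ∀ {x} → x ∈ℚ⟨ a ⟩ → ¬ Shifted M x → ¬ Shifted M (- x) → Kernel x
  kernel-of x∈ x∉L -x∉L = kernel
    (fromInj₁ (λ l → ⊥-elim (x∉L l)) (classify x∈))
    (fromInj₁ (λ l → ⊥-elim (-x∉L l)) (classify (neg-∈ x∈)))

  -- If x or -x were in L, a translate of it would be in M, and x would have slope 1 or -1 relative
  -- to that translate.
  algebraic⇒kernel : ∀ {x} → x ∈ℚ⟨ a ⟩ → AlgebraicOverℚ x → Kernel x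
  algebraic⇒kernel {x} x∈ alg = kernel-of x∈
    (λ (shifted N h) → algebraic-slope≢±1 h {ρ = 1ℚ} refl alg
      (slope-resp-≗ (λ n → up (seq x n) N) (λ _ → refl) (slope-affine h 1ℚ (ℚ.- N))))
    (λ (shifted N h) → algebraic-slope≢±1 h {ρ = ℚ.- 1ℚ} refl alg
      (slope-resp-≗ (λ n → down (seq x n) N) (λ _ → refl) (slope-affine h (ℚ.- 1ℚ) N)))
    where
    up : ∀ x N → 1ℚ ℚ.* (x ℚ.+ N) ℚ.+ ℚ.- N ≡ x
    up = solve-∀ ℚ-ring
    down : ∀ x N → ℚ.- 1ℚ ℚ.* (ℚ.- x ℚ.+ N) ℚ.+ N ≡ x
    down = solve-∀ ℚ-ring

  kernel-resp : ∀ {x y} → x ≈ y → Kernel x → Kernel y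
  kernel-resp x≈y (kernel u -u) =
    kernel (U.shifted-resp x≈y u) (U.shifted-resp (neg-cong x≈y) -u)

  kernel-rational : ∀ q → Kernel (fromℚ q)
  kernel-rational q = kernel (rational∈U q) (U.shifted-resp-≗ (λ _ → refl) (rational∈U (ℚ.- q)))

  kernel-neg : ∀ {x} → Kernel x → Kernel (- x)
  kernel-neg {x} (kernel u -u) = kernel -u (U.shifted-resp-≗ (λ n → sym (neg-neg (seq x n))) u)

  kernel-+ : ∀ {x y} → Kernel x → Kernel y → Kernel (x + y)
  kernel-+ {x} {y} (kernel u -u) (kernel v -v) = kernel (U.shifted-+ u v)
    (U.shifted-resp-≗ (λ n → sym (ℚₚ.neg-distrib-+ (seq x n) (seq y n))) (U.shifted-+ -u -v))

  -- Scalars of either sign are allowed in order to cancel the cross terms in `kernel-*-U`.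
  kernel-scale : ∀ {x} q → Kernel x → Shifted P (fromℚ q * x)
  kernel-scale {x} q (kernel u -u) = go (ℚₚ.<-cmp 0ℚ q)
    where
    negate : ∀ q x → ℚ.- q ℚ.* ℚ.- x ≡ q ℚ.* x
    negate = solve-∀ ℚ-ring
    go : Tri (0ℚ ℚ.< q) (0ℚ ≡ q) (q ℚ.< 0ℚ) → Shifted P (fromℚ q * x)
    go (tri< 0<q _ _)  = U.shifted-scale 0<q u
    go (tri≈ _ refl _) = U.shifted-resp-≗ (λ n → sym (ℚₚ.*-zeroˡ (seq x n))) (rational∈U 0ℚ)
    go (tri> _ _ q<0)  = U.shifted-resp-≗ (λ n → negate q (seq x n)) (U.shifted-scale (0<-neg q<0) -u)

  kernel-*-U : ∀ {x y} → Kernel x → Kernel y → Shifted P (x * y)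
  kernel-*-U {x} {y} h k =
    let q , _ , 0<x+q = lower-bound x
        r , _ , 0<y+r = lower-bound y
    in U.shifted-resp-≗ (λ n → cancel (seq x n) (seq y n) q r)
         (U.shifted-+ (U.shifted-* q r (Kernel.x∈U h) (Kernel.x∈U k) 0<x+q 0<y+r)
           (U.shifted-+ (kernel-scale (ℚ.- q) k) (kernel-scale (ℚ.- r) h)))
    where
    cancel : ∀ x y q r → (x ℚ.* y ℚ.+ (q ℚ.* y ℚ.+ r ℚ.* x)) ℚ.+ (ℚ.- q ℚ.* y ℚ.+ ℚ.- r ℚ.* x)
                       ≡ x ℚ.* y
    cancel = solve-∀ ℚ-ring

  kernel-* : ∀ {x y} → Kernel x → Kernel y → Kernel (x * y)
  kernel-* {x} {y} h k = kernel (kernel-*-U h k)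
    (U.shifted-resp-≗ (λ n → sym (ℚₚ.neg-distribˡ-* (seq x n) (seq y n))) (kernel-*-U (kernel-neg h) k))

  -- For s < 0, -sx lies in L. If y - sx were in U, adding -y from U would put -sx in U.
  kernel⇒slope≡0 : ∀ {x y} → M x → Kernel y → Slope x y 0ℝ
  kernel⇒slope≡0 {x} {y} x∈M k = slope y∈
    (lower0 y∈ (Kernel.-x∈U k))
    (lowerSlope-resp-≗ (λ _ → refl) (λ _ → refl)
      (lower0 (neg-∈ y∈) (Kernel.-x∈U (kernel-neg k))))
    where
    y∈ = U.shifted-member (Kernel.x∈U k)
    collect : ∀ s x → (0ℚ ℚ.- s) ℚ.* x ≡ ℚ.- (s ℚ.* x)
    collect = solve-∀ ℚ-ring
    cancel : ∀ y t → ℚ.- y ℚ.+ (y ℚ.+ t) ≡ t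
    cancel = solve-∀ ℚ-ring
    lower0 : ∀ {z} → z ∈ℚ⟨ a ⟩ → Shifted P (- z) → LowerSlope x z 0ℝ
    lower0 {z} z∈ -z∈U = lowerSlope λ s p →
      fromInj₂ (λ u → ⊥-elim (L∩U≡∅ { - (fromℚ s * x)}
          (L.shifted-resp-≗ (λ n → collect s (seq x n))
            (L.shifted-scale (Pos-fromℚ⁻¹ (Pos-resp-≗ {y = fromℚ (0ℚ ℚ.- s)} (λ _ → refl) p))
              (L.shifted-of x∈M)))
          (U.shifted-resp-≗ (λ n → cancel (seq z n) (ℚ.- (s ℚ.* seq x n))) (U.shifted-+ -z∈U u))))
        (classify (+-∈ z∈ (neg-∈ (*-∈ (rational∈ s) (M.member x∈M)))))

  -- If x were in L, then relative to a translate of x in M it would have slope 1 and y slope 0,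
  -- contradicting xy = 1. For -x, use (-x)(-y) = 1.
  kernel-inverse : ∀ {x y} → x ∈ℚ⟨ a ⟩ → x * y ≈ 1ℝ → Kernel y → Kernel x
  kernel-inverse {x} {y} x∈ xy≈1 k = kernel-of x∈ (absurd xy≈1 k)
    (absurd (≈-trans (≗⇒≈ (λ n → negate (seq x n) (seq y n))) xy≈1) (kernel-neg k))
    where
    negate : ∀ x y → ℚ.- x ℚ.* ℚ.- y ≡ x ℚ.* y
    negate = solve-∀ ℚ-ring
    unshift : ∀ x N → 1ℚ ℚ.* (x ℚ.+ N) ℚ.+ ℚ.- N ≡ x
    unshift = solve-∀ ℚ-ring
    absurd : ∀ {x y} → x * y ≈ 1ℝ → Kernel y → ¬ Shifted M x
    absurd {x} xy≈1 k (shifted N h) = slope1∙slope0≉1 h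
      (slope-resp-≗ (λ n → unshift (seq x n) N) (λ _ → refl) (slope-affine h 1ℚ (ℚ.- N)))
      (kernel⇒slope≡0 h k) xy≈1

  ∈⇒kernel : AlgebraicOverℚ a → ∀ {x} → x ∈ℚ⟨ a ⟩ → Kernel x
  -- Algebraicity is applied at the generator; the other cases are closure properties of the kernel.
  ∈⇒kernel alg (gen x≈a)         =
    kernel-resp (≈-sym x≈a) (algebraic⇒kernel (gen (≗⇒≈ λ _ → refl)) alg)
  ∈⇒kernel alg (rat q x≈q)       = kernel-resp (≈-sym x≈q) (kernel-rational q)
  ∈⇒kernel alg (add y∈ z∈ x≈y+z) =
    kernel-resp (≈-sym x≈y+z) (kernel-+ (∈⇒kernel alg y∈) (∈⇒kernel alg z∈))
  ∈⇒kernel alg (neg y∈ x≈-y)     = kernel-resp (≈-sym x≈-y) (kernel-neg (∈⇒kernel alg y∈))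
  ∈⇒kernel alg (mul y∈ z∈ x≈y*z) =
    kernel-resp (≈-sym x≈y*z) (kernel-* (∈⇒kernel alg y∈) (∈⇒kernel alg z∈))
  ∈⇒kernel alg (inv y∈ xy≈1)     = kernel-inverse (inv y∈ xy≈1) xy≈1 (∈⇒kernel alg y∈)

  M≡∅ : AlgebraicOverℚ a → ∀ {x} → ¬ M x
  M≡∅ alg x∈M = L∩U≡∅ (L.shifted-of x∈M) (Kernel.x∈U (∈⇒kernel alg (M.member x∈M)))

theorem1p2 : ∀ {ℓ : Level} (a : ℝ) → AlgebraicOverℚ a →
    ¬ (∃₂ λ (H₁ H₂ : Pred ℝ ℓ) →
    (H₁ Respects _≈_) × (H₂ Respects _≈_) ×
    (ℚ⟨ a ⟩⁺ ≐ (H₁ ∪ H₂)) × (H₁ ⊥ H₂) ×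
    Satisfiable H₁ × Satisfiable H₂ ×
    ClosedUnder _+_ H₁ × ClosedUnder _*_ H₁ ×
    ClosedUnder _+_ H₂ × ClosedUnder _*_ H₂)
theorem1p2 a alg (H₁ , H₂ , H₁-resp , H₂-resp , (⊆H₁∪H₂ , H₁∪H₂⊆) , H₁⊥H₂ ,
                  (x₁ , x₁∈H₁) , (x₂ , x₂∈H₂) , H₁-+ , H₁-* , H₂-+ , H₂-*) =
  -- Whichever part contains 1 takes the role of P, and the other is then empty.
  Sum.[ (λ 1∈H₁ → Splitting.M≡∅ part₁ part₂ split disjoint 1∈H₁ alg x₂∈H₂)
      , (λ 1∈H₂ → Splitting.M≡∅ part₂ part₁
           (λ x∈ 0<x → Sum.swap (split x∈ 0<x)) (λ x∈H₂ x∈H₁ → disjoint x∈H₁ x∈H₂)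
           1∈H₂ alg x₁∈H₁)
      ] (split (rational∈ 1ℚ) (Pos-fromℚ (ℚₚ.positive⁻¹ 1ℚ)))
  where
  part₁ : IsPart a H₁
  part₁ = record
    { resp     = H₁-resp
    ; member   = λ h → proj₁ (H₁∪H₂⊆ (inj₁ h))
    ; positive = λ h → proj₂ (H₁∪H₂⊆ (inj₁ h))
    ; +-closed = H₁-+
    ; *-closed = H₁-*
    }
  part₂ : IsPart a H₂
  part₂ = record
    { resp     = H₂-resp
    ; member   = λ h → proj₁ (H₁∪H₂⊆ (inj₂ h))
    ; positive = λ h → proj₂ (H₁∪H₂⊆ (inj₂ h))
    ; +-closed = H₂-+
    ; *-closed = H₂-*
    }
  split : ∀ {x} → x ∈ℚ⟨ a ⟩ → Pos x → H₁ x ⊎ H₂ x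
  split x∈ 0<x = ⊆H₁∪H₂ (x∈ , 0<x)
  disjoint : ∀ {x} → H₁ x → ¬ H₂ x
  disjoint h k = H₁⊥H₂ (h , k)
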